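{- Over infinite full-binary trees the following hold: (1) For every integer $k>1$ there is a regular tree language that is $k$-ambiguous but not $(k-1)$-ambiguous. (2) There is a regular tree language that is finitely ambiguous but not boundedly ambiguous. (3) There is a regular tree language that is countably ambiguous but not finitely ambiguous. (4) There is a regular tree language that is not countably ambiguous (i.e. it is uncountably ambiguous but not countably ambiguous).
   Context: Trees: the full-binary tree has node set $\{l,r\}^*$ with root $\epsilon$; for a finite alphabet $\Sigma$, a $\Sigma$-labeled tree is a function $t:\{l,r\}^*\to\Sigma$, and $T^\omega_\Sigma$ is the set of all such trees. A branch is a sequence $v_0=\epsilon, v_1,\dots$ with $v_{i+1}\in\{v_i l, v_i r\}$. A parity tree automaton (PTA) is $\mathcal{A}=(Q,\Sigma,Q_I,\delta,\mathbb{C})$ with $Q$ finite, $Q_I\subseteq Q$, $\delta\subseteq Q\times\Sigma\times Q\times Q$, $\mathbb{C}:Q\to\mathbb{N}$. A computation on $t$ is $\phi:\{l,r\}^*\to Q$ with $\phi(\epsilon)\in Q_I$ and $(\phi(v),t(v),\phi(vl),\phi(vr))\in\delta$ for all $v$; it is accepting if on every branch the maximal color occurring infinitely often in $\mathbb{C}(\phi(v_0))\mathbb{C}(\phi(v_1))\dots$ is even. $ACC(\mathcal{A},t)$ is the set of accepting computations on $t$, and $L(\mathcal{A})=\{t: ACC(\mathcal{A},t)\neq\emptyset\}$. A tree language is regular if it is accepted by a PTA. An automaton is $k$-ambiguous if $|ACC(\mathcal{A},t)|\le k$ for all $t$; boundedly ambiguous if it is $k$-ambiguous for some $k\in\mathbb{N}$;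 finitely (resp. countably) ambiguous if $ACC(\mathcal{A},t)$ is finite (resp. countable) for all $t$. A regular language is $k$-ambiguous (resp. boundedly, finitely, countably ambiguous) if it is accepted by some PTA with that property. -}

module Defs where

open import Data.Nat using (ℕ; zero; suc; _≤_; _∸_)
open import Data.Nat.Divisibility using (_∣_)
open import Data.Fin using (Fin)
open import Data.List using (List; []; _∷_)
open import Data.List.Membership.Propositional using (_∈_)
open import Data.Bool using (Bool; true)
open import Data.Product using (Σ; ∃; ∃-syntax; _×_; _,_)
open import Relation.Binary.PropositionalEquality using (_≡_; _≢_)
open import Relation.Nullary using (¬_)
open import Function.Bundles using (_⇔_)

-- Directions and nodes of the full binary tree {l,r}*.
-- Convention: a node is the list of directions from the root, stored
-- in REVERSE order, so the children of v are  l ∷ v  and  r ∷ v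
-- (this is a bijective re-encoding of {l,r}*; the root is []).
data Dir : Set where
  l r : Dir

Node : Set
Node = List Dir

Tree : ℕ → Set
Tree n = Node → Fin n

branchNode : (ℕ → Dir) → ℕ → Node
branchNode b zero    = []
branchNode b (suc i) = b i ∷ branchNode b i

record PTA (n : ℕ) : Set where
  field
    m      : ℕ
    init   : Fin m → Bool
    δ      : Fin m → Fin n → Fin m → Fin m → Bool
    color  : Fin m → ℕ
open PTA public

Labeling : ∀ {n} → PTA n → Set
Labeling A = Node → Fin (m A)

IsComputation : ∀ {n} (A : PTA n) → Tree n → Labeling A → Set
IsComputation A t φ =
  (init A (φ []) ≡ true) ×
  (∀ v → δ A (φ v) (t v) (φ (l ∷ v)) (φ (r ∷ v)) ≡ true)

-- Parity condition on a color sequence: the maximal color occurring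
-- infinitely often is even.  (c has finite range, so such a maximum exists.)
InfOften : (ℕ → Set) → Set
InfOften P = ∀ k → ∃[ i ] (k ≤ i × P i)

ParityAccepts : (ℕ → ℕ) → Set
ParityAccepts c =
  ∃[ e ] (2 ∣ e × InfOften (λ i → c i ≡ e) ×
          ∃[ k ] (∀ i → k ≤ i → c i ≤ e))

IsAccepting : ∀ {n} (A : PTA n) → Labeling A → Set
IsAccepting A φ = ∀ (b : ℕ → Dir) → ParityAccepts (λ i → color A (φ (branchNode b i)))

ACC : ∀ {n} (A : PTA n) → Tree n → Labeling A → Set
ACC A t φ = IsComputation A t φ × IsAccepting A φ

Accepts : ∀ {n} → PTA n → Tree n → Set
Accepts A t = ∃[ φ ] ACC A t φ

_≗ᴸ_ : ∀ {n} {A : PTA n} → Labeling A → Labeling A → Set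
φ ≗ᴸ ψ = ∀ v → φ v ≡ ψ v

SameLanguage : ∀ {n} → PTA n → PTA n → Set
SameLanguage A B = ∀ t → Accepts A t ⇔ Accepts B t

Ambiguous≤ : ∀ {n} → ℕ → PTA n → Set
Ambiguous≤ {n} k A =
  ∀ (t : Tree n) (φs : Fin (suc k) → Labeling A) →
  (∀ i → ACC A t (φs i)) →
  ∃[ i ] ∃[ j ] (i ≢ j × _≗ᴸ_ {A = A} (φs i) (φs j))

BoundedlyAmbiguous : ∀ {n} → PTA n → Set
BoundedlyAmbiguous A = ∃[ k ] Ambiguous≤ k A

FinitelyAmbiguous : ∀ {n} → PTA n → Set
FinitelyAmbiguous {n} A =
  ∀ (t : Tree n) → Σ (List (Labeling A)) λ fs → (∀ φ → ACC A t φ →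
    ∃[ ψ ] (ψ ∈ fs × _≗ᴸ_ {A = A} ψ φ))

CountablyAmbiguous : ∀ {n} → PTA n → Set
CountablyAmbiguous {n} A =
  ∀ (t : Tree n) → Σ (ℕ → Labeling A) λ f → (∀ φ → ACC A t φ →
    ∃[ i ] (_≗ᴸ_ {A = A} (f i) φ))

-- Ambiguity classes of the regular language L(A): the language has
-- property P iff some PTA accepting exactly L(A) has property P.
-- "L(A) does not have P" is stated as: every B with L(B) = L(A) fails P.
NoEquivalent : ∀ {n} → (PTA n → Set) → PTA n → Set
NoEquivalent {n} P A = ∀ (B : PTA n) → SameLanguage A B → ¬ P B

{-# OPTIONS --safe #-}

-- A run of an automaton B may carry states q that refuse the blank tree (all labels 0F), and such a
-- state certifies that a label 1F occurs below. The key fact (`decoy`) is that this certificate is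
-- never unambiguous: some tree y containing 1F has, from every state that accepts y but not the
-- blank tree, infinitely many runs.
--
-- The tree y is a tower of combs: all labels on the left spine of a comb of rank 1 + j are 0F, its
-- first N teeth (the subtrees to the right of the spine) are combs of the top rank M, the remaining
-- ones have rank j, and rank 0 is the all-1F tree. By the pigeonhole principle the states accepting
-- rank z and rank M agree for some z < M, so to B the combs of rank 1 + z have identical teeth.
-- In a run on y, the spine of such a comb repeats a state within the first teeth. If the spine
-- states are not periodic from there on, the loop can be pumped, and the different pumpings are
-- told apart by the first deviation from periodicity. If they are periodic for all such combs, the
-- run folds: every spine of rank 1 + z stays among the first teeth, so the run never gets below
-- rank 1 + z and becomes a run on the blank tree.
--
-- Given the decoy y, (3) is witnessed by "1F occurs somewhere", and (4) by "1F occurs in every tooth"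
-- since each of the infinitely many teeth then admits two runs. For (1) and (2) the language is
-- "some tooth before the end of a clock on the spine is blank", where the clock counts to k, or
-- respectively stops at the first 1F on the spine; with decoys on all teeth but one, each eligible
-- tooth has to contribute a run of its own.

module Submission where

open import Defs
open import Axiom.ExcludedMiddle using (ExcludedMiddle)
open import Level using (0ℓ)
open import Data.Bool using (Bool; true; false; if_then_else_)
open import Data.Empty using (⊥)
open import Data.Fin as Fin using (Fin; toℕ; fromℕ; fromℕ<; inject₁; splitAt; _↑ˡ_; _↑ʳ_; funToFin; finToFun)
open import Data.Fin.Patterns using (0F; 1F; 2F)
import Data.Fin.Properties as Fin
open import Data.List using (List; []; _∷_; _++_; length; foldr; map; upTo; _ʳ++_; reverse; lookup)
open import Data.List.Membership.Propositional using (_∈_)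
open import Data.List.Membership.Propositional.Properties using (∈-map⁺; ∈-upTo⁺)
open import Data.List.Properties
  using (++-assoc; ++-identityʳ; length-++; ≡-dec; foldr-++; reverse-involutive; ∷-injectiveʳ)
open import Data.List.Relation.Unary.Any using (index)
open import Data.List.Relation.Unary.Any.Properties using (lookup-index)
open import Data.Maybe using (Maybe; just; nothing; maybe′; _>>=_)
open import Data.Nat
open import Data.Nat.Divisibility using (_∣_; _∣0; ∣1⇒≡1)
open import Data.Nat.Induction using (<-rec)
open import Data.Nat.Properties
open import Data.Product using (Σ; ∃; ∃-syntax; _×_; _,_; proj₁; proj₂)
open import Data.Sum using (_⊎_; inj₁; inj₂; [_,_]′)
open import Function using (_∘_)
open import Function.Bundles using (Equivalence)
open import Relation.Binary.Definitions using (tri<; tri≈; tri>)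
open import Relation.Binary.PropositionalEquality
open import Relation.Nullary using (¬_; Dec; yes; no; contradiction; does)
open import Relation.Nullary.Decidable using (decidable-stable; dec-true; dec-false)

spine : ℕ → Node
spine zero    = []
spine (suc i) = l ∷ spine i

length-spine : ∀ i → length (spine i) ≡ i
length-spine zero    = refl
length-spine (suc i) = cong suc (length-spine i)

spine-+ : ∀ i j → spine (i + j) ≡ spine i ++ spine j
spine-+ zero    j = refl
spine-+ (suc i) j = cong (l ∷_) (spine-+ i j)

sub : {X : Set} → (Node → X) → Node → Node → X
sub f v w = f (w ++ v)

-- Parity, branches and runs

parity-cong : ∀ {c c′} → (∀ i → c i ≡ c′ i) → ParityAccepts c → ParityAccepts c′
parity-cong eq (e , even , inf , k , bound) =
  e , even ,
  (λ j → let i , j≤i , ci = inf j in i , j≤i , trans (sym (eq i)) ci) ,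
  k , (λ i k≤i → subst (_≤ e) (eq i) (bound i k≤i))

parity-unshift : ∀ {c} k → ParityAccepts (λ i → c (i + k)) → ParityAccepts c
parity-unshift {c} k (e , even , inf , k′ , bound) =
  e , even ,
  (λ j → let i , j≤i , ci = inf j in i + k , ≤-trans j≤i (m≤m+n i k) , ci) ,
  k′ + k ,
  (λ i le → subst (λ x → c x ≤ e) (m∸n+n≡m (≤-trans (m≤n+m k k′) le))
              (bound (i ∸ k) (m+n≤o⇒m≤o∸n k′ le)))

parity-shift : ∀ {c} k → ParityAccepts c → ParityAccepts (λ i → c (i + k))
parity-shift {c} k (e , even , inf , k′ , bound) =
  e , even ,
  (λ j → let i , le , ci = inf (j + k) in
     i ∸ k , m+n≤o⇒m≤o∸n j le ,
     trans (cong c (m∸n+n≡m (≤-trans (m≤n+m k j) le))) ci) ,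
  k′ , (λ i le → bound (i + k) (≤-trans le (m≤m+n i k)))

shift : ℕ → (ℕ → Dir) → ℕ → Dir
shift k b i = b (i + k)

branch-shift : ∀ b k i → branchNode b (i + k) ≡ branchNode (shift k b) i ++ branchNode b k
branch-shift b k zero    = refl
branch-shift b k (suc i) = cong (b (i + k) ∷_) (branch-shift b k i)

length-branch : ∀ b i → length (branchNode b i) ≡ i
length-branch b zero    = refl
length-branch b (suc i) = cong suc (length-branch b i)

++-split-length : {X : Set} (w w′ : List X) {v v′ : List X} → length v ≡ length v′ →
                  w ++ v ≡ w′ ++ v′ → v ≡ v′
++-split-length []      []       eq p = p
++-split-length []      (x ∷ w′) {v} {v′} eq refl =
  contradiction eq (>⇒≢ (s≤s (subst (length v′ ≤_) (sym (length-++ w′)) (m≤n+m _ _))))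
++-split-length (x ∷ w) []       {v} {v′} eq refl =
  contradiction eq (<⇒≢ (s≤s (subst (length v ≤_) (sym (length-++ w)) (m≤n+m _ _))))
++-split-length (x ∷ w) (y ∷ w′) eq p = ++-split-length w w′ eq (∷-injectiveʳ p)

-- Nodes are stored in reverse, so a suffix is an ancestor. This recovers the moment at which a
-- branch passed through `s`, in particular where it entered a graft.
branch-suffix : ∀ b i w s → branchNode b i ≡ w ++ s → s ≡ branchNode b (length s)
branch-suffix b i w s eq =
  ++-split-length w (branchNode (shift (length s) b) (length w))
    (sym (length-branch b (length s)))
    (trans (sym eq) (trans (cong (branchNode b) len) (branch-shift b (length s) (length w))))
  where
  len : i ≡ length w + length s
  len = trans (sym (length-branch b i)) (trans (cong length eq) (length-++ w))

_◁_ : Dir → (ℕ → Dir) → ℕ → Dir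
(d ◁ b) zero    = d
(d ◁ b) (suc i) = b i

-- The head of a node is its last direction, so it is put in front of `b` before the rest of the
-- node.
prepend : Node → (ℕ → Dir) → ℕ → Dir
prepend []      b = b
prepend (d ∷ v) b = prepend v (d ◁ b)

branch-◁ : ∀ d b i → branchNode (d ◁ b) (suc i) ≡ branchNode b i ++ d ∷ []
branch-◁ d b zero    = refl
branch-◁ d b (suc i) = cong (b i ∷_) (branch-◁ d b i)

branch-prepend : ∀ v b i → branchNode (prepend v b) (i + length v) ≡ branchNode b i ++ v
branch-prepend []      b i = trans (cong (branchNode b) (+-identityʳ i)) (sym (++-identityʳ (branchNode b i)))
branch-prepend (d ∷ v) b i = begin
  branchNode (prepend v (d ◁ b)) (i + suc (length v))
    ≡⟨ cong (branchNode (prepend v (d ◁ b))) (+-suc i (length v)) ⟩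
  branchNode (prepend v (d ◁ b)) (suc i + length v)
    ≡⟨ branch-prepend v (d ◁ b) (suc i) ⟩
  branchNode (d ◁ b) (suc i) ++ v
    ≡⟨ cong (_++ v) (branch-◁ d b i) ⟩
  (branchNode b i ++ d ∷ []) ++ v
    ≡⟨ ++-assoc (branchNode b i) (d ∷ []) v ⟩
  branchNode b i ++ d ∷ v ∎
  where open ≡-Reasoning

branch-spine : ∀ i → branchNode (λ _ → l) i ≡ spine i
branch-spine zero    = refl
branch-spine (suc i) = cong (l ∷_) (branch-spine i)

-- An accepting computation except that it may start in any state `q`, so that the restriction of a
-- computation to a subtree is again a run.
record Run {n} (A : PTA n) (q : Fin (m A)) (t : Tree n) (φ : Labeling A) : Set where
  constructor run
  field
    root   : φ [] ≡ q
    step   : ∀ v → δ A (φ v) (t v) (φ (l ∷ v)) (φ (r ∷ v)) ≡ true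
    accept : IsAccepting A φ
open Run public

Acc : ∀ {n} (A : PTA n) → Fin (m A) → Tree n → Set
Acc A q t = ∃[ φ ] Run A q t φ

module _ {n} {A : PTA n} where

  run-tree : ∀ {q t t′ φ} → (∀ v → t v ≡ t′ v) → Run A q t φ → Run A q t′ φ
  run-tree {φ = φ} eq (run rt st ac) =
    run rt (λ v → trans (cong (λ a → δ A (φ v) a (φ (l ∷ v)) (φ (r ∷ v))) (sym (eq v))) (st v)) ac

  acc-tree : ∀ {q t t′} → (∀ v → t v ≡ t′ v) → Acc A q t → Acc A q t′
  acc-tree eq (φ , ρ) = φ , run-tree eq ρ

  run-root : ∀ {q q′ t φ} → q ≡ q′ → Run A q t φ → Run A q′ t φ
  run-root refl ρ = ρ

  subrun : ∀ {q t φ} → Run A q t φ → ∀ v → Run A (φ v) (sub t v) (sub φ v)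
  subrun {φ = φ} (run rt st ac) v =
    run refl (λ w → st (w ++ v))
      (λ b → parity-cong (λ i → cong (λ u → color A (φ u)) (branch-prepend v b i))
               (parity-shift (length v) (ac (prepend v b))))

  acc⇒run : ∀ {t φ} → ACC A t φ → Run A (φ []) t φ
  acc⇒run ((_ , st) , ac) = run refl st ac

  run⇒acc : ∀ {q t φ} → init A q ≡ true → Run A q t φ → ACC A t φ
  run⇒acc iq (run rt st ac) = (trans (cong (init A) rt) iq , st) , ac

-- Grafting

data Loc : Set where
  out : Loc
  inn : Node → Node → Loc

module Graft (cut : Node → Bool) where

  enter : Node → Loc
  enter x = if cut x then inn x [] else out

  -- Only the topmost cut on a path counts: inside a graft, `cut` is no longer consulted.
  ext : Dir → Node → Loc → Loc
  ext d x out       = enter (d ∷ x)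
  ext d x (inn s w) = inn s (d ∷ w)

  loc : Node → Loc
  loc []      = enter []
  loc (d ∷ x) = ext d x (loc x)

  pick : {X : Set} → (Node → X) → (Node → Node → X) → Node → Loc → X
  pick f ρ x out       = f x
  pick f ρ x (inn s w) = ρ s w

  graft : {X : Set} → (Node → X) → (Node → Node → X) → Node → X
  graft f ρ x = pick f ρ x (loc x)

  enter-sound : ∀ x {s w} → enter x ≡ inn s w → s ≡ x × w ≡ []
  enter-sound x eq with cut x
  enter-sound x refl | true  = refl , refl
  enter-sound x ()   | false

  loc-sound : ∀ x {s w} → loc x ≡ inn s w → x ≡ w ++ s × loc s ≡ inn s []
  loc-sound [] eq with enter-sound [] eq
  ... | refl , refl = refl , eq
  loc-sound (d ∷ x) eq with loc x in e
  ... | out with enter-sound (d ∷ x) eq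
  ...   | refl , refl = refl , trans (cong (ext d x) e) eq
  loc-sound (d ∷ x) refl | inn s w with loc-sound x e
  ...   | refl , ls = refl , ls

  loc-++ : ∀ {s} → loc s ≡ inn s [] → ∀ w → loc (w ++ s) ≡ inn s w
  loc-++ e []      = e
  loc-++ {s} e (d ∷ w) = cong (ext d (w ++ s)) (loc-++ e w)

  graft-inn : {X : Set} (f : Node → X) (ρ : Node → Node → X) {s : Node} →
              loc s ≡ inn s [] → ∀ w → graft f ρ (w ++ s) ≡ ρ s w
  graft-inn f ρ {s} e w = cong (pick f ρ (w ++ s)) (loc-++ e w)

  graft-out : {X : Set} (f : Node → X) (ρ : Node → Node → X) →
              ∀ x → loc x ≡ out → graft f ρ x ≡ f x
  graft-out f ρ x e = cong (pick f ρ x) e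

  -- The child of an outside node may be a cut; the grafted piece then starts with the value of `f`,
  -- so transitions into a graft remain valid.
  graft-edge : {X : Set} {f : Node → X} {ρ : Node → Node → X} →
               (∀ s → loc s ≡ inn s [] → ρ s [] ≡ f s) →
               ∀ d x → loc x ≡ out → graft f ρ (d ∷ x) ≡ f (d ∷ x)
  graft-edge {f = f} {ρ} agree d x e with loc (d ∷ x) in e′
  ... | out     = refl
  ... | inn s w with enter-sound (d ∷ x) (trans (sym (cong (ext d x) e)) e′)
  ...   | refl , refl = agree s e′

  graft-root : {X : Set} {f : Node → X} {ρ : Node → Node → X} →
               (∀ s → loc s ≡ inn s [] → ρ s [] ≡ f s) → graft f ρ [] ≡ f []
  graft-root {f = f} {ρ} agree with loc [] in e
  ... | out     = refl
  ... | inn s w with enter-sound [] e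
  ...   | refl , refl = agree s e

  module _ (em : ExcludedMiddle 0ℓ) {n} {A : PTA n} {t : Tree n}
           {f : Labeling A} {ρ : Node → Labeling A}
           (steps  : ∀ x → loc x ≡ out → δ A (f x) (t x) (f (l ∷ x)) (f (r ∷ x)) ≡ true)
           (inner  : ∀ s → loc s ≡ inn s [] → Run A (f s) (sub t s) (ρ s))
           (parity : ∀ b → (∀ i → loc (branchNode b i) ≡ out) →
                     ParityAccepts (λ i → color A (f (branchNode b i))))
    where

    private
      agree : ∀ s → loc s ≡ inn s [] → ρ s [] ≡ f s
      agree s e = root (inner s e)

      g : Labeling A
      g = graft f ρ

      g-step : ∀ x → δ A (g x) (t x) (g (l ∷ x)) (g (r ∷ x)) ≡ true
      g-step x with loc x in e
      ... | out = subst₂ (λ y z → δ A (f x) (t x) y z ≡ true)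
                    (sym (edge l)) (sym (edge r)) (steps x e)
        where edge : ∀ d → pick f ρ (d ∷ x) (enter (d ∷ x)) ≡ f (d ∷ x)
              edge d = trans (cong (pick f ρ (d ∷ x)) (sym (cong (ext d x) e))) (graft-edge agree d x e)
      ... | inn s w with loc-sound x e
      ...   | refl , ls = step (inner s ls) w

      g-accept : IsAccepting A g
      g-accept b with em {∃[ i ] (loc (branchNode b i) ≢ out)}
      ... | no  never = parity-cong (λ i → cong (color A) (sym (graft-out f ρ _ (all i)))) (parity b all)
        where
        out? : ∀ e → Dec (e ≡ out)
        out? out       = yes refl
        out? (inn _ _) = no λ ()
        all : ∀ i → loc (branchNode b i) ≡ out
        all i = decidable-stable (out? _) λ ne → never (i , ne)
      ... | yes (i , ne) with loc (branchNode b i) in e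
      ...   | out     = contradiction refl ne
      ...   | inn s w with loc-sound (branchNode b i) e
      ...     | eq , ls = parity-unshift (length s)
                (parity-cong (λ j → cong (color A) (sym (at j)))
                  (accept (inner s ls) (shift (length s) b)))
        where
        at : ∀ j → g (branchNode b (j + length s)) ≡ ρ s (branchNode (shift (length s) b) j)
        at j = trans (cong g (trans (branch-shift b (length s) j)
                       (cong (branchNode (shift (length s) b) j ++_)
                         (sym (branch-suffix b i w s eq)))))
                 (graft-inn f ρ ls _)

    -- A branch either avoids all grafts, where `parity` applies, or stays in a single graft from
    -- some point on and inherits acceptance from the run there, because parity ignores finite
    -- prefixes.
    graft-run : Run A (f []) t (graft f ρ)
    graft-run = run (graft-root agree) g-step g-accept

-- Combs: a left spine with a subtree hanging off to the right of each spine node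

-- Since only the topmost cut on a path takes effect, cutting at all right children makes exactly
-- the teeth into grafts and leaves the spine outside.
isRight : Node → Bool
isRight (r ∷ _) = true
isRight _       = false

private module G = Graft isRight

tooth : ℕ → Node
tooth i = r ∷ spine i

toothIndex : Node → ℕ
toothIndex []      = 0
toothIndex (_ ∷ x) = length x

-- The last direction and the length determine a node on the spine or at the root of a tooth; the
-- values at all other nodes are overridden by the grafts.
combBase : {X : Set} → (ℕ → X) → (ℕ → X) → Node → X
combBase p q []      = p 0
combBase p q (l ∷ x) = p (suc (length x))
combBase p q (r ∷ x) = q (length x)

comb : {X : Set} → (ℕ → X) → (ℕ → Node → X) → Node → X
comb p ρ = G.graft (combBase p (λ i → ρ i [])) (λ s → ρ (toothIndex s))

loc-spine : ∀ i → G.loc (spine i) ≡ out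
loc-spine zero    = refl
loc-spine (suc i) = cong (G.ext l (spine i)) (loc-spine i)

loc-tooth : ∀ i → G.loc (tooth i) ≡ inn (tooth i) []
loc-tooth i = cong (G.ext r (spine i)) (loc-spine i)

combBase-spine : {X : Set} (p q : ℕ → X) (i : ℕ) → combBase p q (spine i) ≡ p i
combBase-spine p q zero    = refl
combBase-spine p q (suc i) = cong (λ k → p (suc k)) (length-spine i)

comb-spine : {X : Set} (p : ℕ → X) (ρ : ℕ → Node → X) (i : ℕ) → comb p ρ (spine i) ≡ p i
comb-spine p ρ i = trans (G.graft-out _ _ (spine i) (loc-spine i)) (combBase-spine p _ i)

comb-tooth : {X : Set} (p : ℕ → X) (ρ : ℕ → Node → X) (i : ℕ) (w : Node) →
             comb p ρ (w ++ tooth i) ≡ ρ i w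
comb-tooth p ρ i w = trans (G.graft-inn _ _ (loc-tooth i) w) (cong (λ k → ρ k w) (length-spine i))

loc-out⇒spine : ∀ x → G.loc x ≡ out → x ≡ spine (length x)
loc-out⇒spine []      e = refl
loc-out⇒spine (d ∷ x) e with G.loc x in e′
loc-out⇒spine (l ∷ x) e  | out     = cong (l ∷_) (loc-out⇒spine x e′)
loc-out⇒spine (r ∷ x) () | out
loc-out⇒spine (d ∷ x) () | inn s w

loc-cut⇒tooth : ∀ s → G.loc s ≡ inn s [] → s ≡ tooth (length s ∸ 1)
loc-cut⇒tooth (d ∷ x) e with G.loc x in e′
loc-cut⇒tooth (l ∷ x) () | out
loc-cut⇒tooth (r ∷ x) e  | out     = cong (r ∷_) (loc-out⇒spine x e′)
loc-cut⇒tooth (d ∷ x) () | inn s w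

-- The only branch that never enters a tooth is the spine itself, so outside the teeth parity
-- concerns just the sequence `p`.
comb-run : ExcludedMiddle 0ℓ → ∀ {n} {A : PTA n} (t : Tree n) (p : ℕ → Fin (m A))
           (q : ℕ → Fin (m A)) (ρ : ℕ → Labeling A) →
           (∀ i → δ A (p i) (t (spine i)) (p (suc i)) (q i) ≡ true) →
           ParityAccepts (λ i → color A (p i)) →
           (∀ i → Run A (q i) (sub t (tooth i)) (ρ i)) →
           Run A (p 0) t (comb p ρ)
comb-run em {A = A} t p q ρ steps par inner = G.graft-run em steps′ inner′ par′
  where
  base : Labeling A
  base = combBase p (λ i → ρ i [])

  steps′ : ∀ x → G.loc x ≡ out → δ A (base x) (t x) (base (l ∷ x)) (base (r ∷ x)) ≡ true
  steps′ x e = subst (λ x → δ A (base x) (t x) (base (l ∷ x)) (base (r ∷ x)) ≡ true)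
                 (sym (loc-out⇒spine x e)) (lemma (length x))
    where
    lemma : ∀ i → δ A (base (spine i)) (t (spine i)) (base (spine (suc i))) (base (tooth i)) ≡ true
    lemma i rewrite combBase-spine p (λ i → ρ i []) i | length-spine i | root (inner i) = steps i

  inner′ : ∀ s → G.loc s ≡ inn s [] → Run A (base s) (sub t s) (ρ (toothIndex s))
  inner′ s e = subst (λ s → Run A (base s) (sub t s) (ρ (toothIndex s)))
                 (sym (loc-cut⇒tooth s e)) (lemma (length s ∸ 1))
    where
    lemma : ∀ i → Run A (base (tooth i)) (sub t (tooth i)) (ρ (toothIndex (tooth i)))
    lemma i rewrite length-spine i = run-root (sym (root (inner i))) (inner i)

  par′ : ∀ b → (∀ i → G.loc (branchNode b i) ≡ out) →
         ParityAccepts (λ i → color A (base (branchNode b i)))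
  par′ b all = parity-cong (λ i → cong (color A) (sym (lemma i))) par
    where
    lemma : ∀ i → base (branchNode b i) ≡ p i
    lemma i = trans (cong base (trans (loc-out⇒spine (branchNode b i) (all i)) (cong spine (length-branch b i))))
                (combBase-spine p _ i)

spine-accept : ∀ {n} {A : PTA n} {q t φ} → Run A q t φ → ParityAccepts (λ i → color A (φ (spine i)))
spine-accept {A = A} {φ = φ} ρ =
  parity-cong (λ i → cong (λ x → color A (φ x)) (branch-spine i)) (accept ρ (λ _ → l))

-- Replacing a single subtree, and least witnesses

_≟ᴰ_ : (d d′ : Dir) → Dec (d ≡ d′)
l ≟ᴰ l = yes refl
l ≟ᴰ r = no λ ()
r ≟ᴰ l = no λ ()
r ≟ᴰ r = yes refl

module Replace (s : Node) where

  at : Node → Bool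
  at x = does (≡-dec _≟ᴰ_ x s)

  open Graft at

  replace : {X : Set} → (Node → X) → (Node → X) → Node → X
  replace f ψ = graft f (λ _ → ψ)

  loc-above : ∀ x → length x < length s → loc x ≡ out
  loc-above [] lt with ≡-dec _≟ᴰ_ [] s
  ... | yes eq = contradiction (cong length eq) (<⇒≢ lt)
  ... | no  _  = refl
  loc-above (d ∷ x) lt rewrite loc-above x (<-trans (n<1+n _) lt) with ≡-dec _≟ᴰ_ (d ∷ x) s
  ... | yes eq = contradiction (cong length eq) (<⇒≢ lt)
  ... | no  _  = refl

  enter-here : enter s ≡ inn s []
  enter-here with ≡-dec _≟ᴰ_ s s
  ... | yes _ = refl
  ... | no ne = contradiction refl ne

  loc-here : loc s ≡ inn s []
  loc-here = lemma s refl
    where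
    lemma : ∀ x → x ≡ s → loc x ≡ inn s []
    lemma []      refl = enter-here
    lemma (d ∷ x) refl = trans (cong (ext d x) (loc-above x ≤-refl)) enter-here

  cut-here : ∀ x → loc x ≡ inn x [] → x ≡ s
  cut-here x e = lemma (enters x e)
    where
    enters : ∀ x → loc x ≡ inn x [] → enter x ≡ inn x []
    enters []      e = e
    enters (d ∷ x) e with loc x
    enters (d ∷ x) e  | out     = e
    enters (d ∷ x) () | inn _ _
    lemma : enter x ≡ inn x [] → x ≡ s
    lemma e with ≡-dec _≟ᴰ_ x s
    lemma e  | yes eq = eq
    lemma () | no _

  replace-here : {X : Set} (f ψ : Node → X) (w : Node) → replace f ψ (w ++ s) ≡ ψ w
  replace-here f ψ w = graft-inn f (λ _ → ψ) loc-here w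

  replace-run : ExcludedMiddle 0ℓ → ∀ {n} {A : PTA n} {q t φ ψ} → Run A q t φ →
                Run A (φ s) (sub t s) ψ → Run A q t (replace φ ψ)
  replace-run em {A = A} {t = t} {φ} {ψ} ρ σ = run-root (root ρ)
    (graft-run em (λ x _ → step ρ x)
      (λ x e → subst (λ x → Run A (φ x) (sub t x) ψ) (sym (cut-here x e)) σ)
      (λ b _ → accept ρ b))

Infinite : ∀ {n} (A : PTA n) → Fin (m A) → Tree n → Set
Infinite A q t = Σ (ℕ → Labeling A) λ φs →
  (∀ i → Run A q t (φs i)) × (∀ i j → i ≢ j → ¬ (∀ v → φs i v ≡ φs j v))

-- Each run on the subtree at `s` replaces the old one there and can be read back from the result,
-- so the runs stay distinct.
infinite-above : ExcludedMiddle 0ℓ → ∀ {n} {A : PTA n} {q t φ} → Run A q t φ → ∀ s →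
                 Infinite A (φ s) (sub t s) → Infinite A q t
infinite-above em {φ = φ} ρ s (ψs , runs , distinct) =
  (λ i → replace φ (ψs i)) ,
  (λ i → replace-run em ρ (runs i)) ,
  (λ i j i≢j eq → distinct i j i≢j λ w →
     trans (sym (replace-here φ (ψs i) w)) (trans (eq (w ++ s)) (replace-here φ (ψs j) w)))
  where open Replace s

least : ExcludedMiddle 0ℓ → (P : ℕ → Set) → ∃ P → ∃[ k ] (P k × (∀ j → j < k → ¬ P j))
least em P (k , Pk) = <-rec (λ k → P k → ∃[ k ] (P k × (∀ j → j < k → ¬ P j))) search k Pk
  where
  search : ∀ k → (∀ {j} → j < k → P j → ∃[ k ] (P k × (∀ j → j < k → ¬ P j))) →
           P k → ∃[ k ] (P k × (∀ j → j < k → ¬ P j))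
  search k rec Pk with em {∃[ j ] (j < k × P j)}
  ... | yes (j , j<k , Pj) = rec j<k Pj
  ... | no  none           = k , Pk , λ j j<k Pj → none (j , j<k , Pj)

-- Pumping a loop on the spine

module Pump (a d : ℕ) (0<d : 0 < d) where

  -- Reading a sequence through `pump` plays the positions from `a` up to, but excluding, `a + d`
  -- twice.
  pump : ℕ → ℕ
  pump i = if does (i <? a + d) then i else i ∸ d

  pump-< : ∀ {i} → i < a + d → pump i ≡ i
  pump-< {i} lt rewrite dec-true (i <? a + d) lt = refl

  pump-≥ : ∀ {i} → a + d ≤ i → pump i ≡ i ∸ d
  pump-≥ {i} le rewrite dec-false (i <? a + d) (≤⇒≯ le) = refl

  a<a+d : a < a + d
  a<a+d = m<m+n a 0<d

  module _ {X : Set} where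

    FirstDeviation : (ℕ → X) → ℕ → Set
    FirstDeviation p k = a + d ≤ k × p k ≢ p (k ∸ d) ×
      (∀ j → a + d ≤ j → j < k → p j ≡ p (j ∸ d))

    deviation-unique : ∀ {p p′ k k′} → (∀ i → p i ≡ p′ i) →
                       FirstDeviation p k → FirstDeviation p′ k′ → ¬ (k < k′)
    deviation-unique {p} {p′} {k} eq (le , ne , _) (_ , _ , before) lt =
      ne (trans (eq k) (trans (before k le lt) (sym (eq (k ∸ d)))))

    -- Pumping inserts one more period and thus delays the first deviation by exactly `d`; its
    -- position reveals how often the loop was pumped.
    deviation-pump : ∀ {p k} → FirstDeviation p k → FirstDeviation (p ∘ pump) (k + d)
    deviation-pump {p} {k} (le , ne , before) = ≤-trans le (m≤m+n k d) , ne′ , before′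
      where
      k+d∸d : k + d ∸ d ≡ k
      k+d∸d = m+n∸n≡m k d
      ne′ : p (pump (k + d)) ≢ p (pump (k + d ∸ d))
      ne′ eq rewrite pump-≥ (≤-trans le (m≤m+n k d)) | k+d∸d | pump-≥ le = ne eq
      before′ : ∀ j → a + d ≤ j → j < k + d → p (pump j) ≡ p (pump (j ∸ d))
      before′ j le′ lt rewrite pump-≥ le′ with <-≤-connex (j ∸ d) (a + d)
      ... | inj₁ lo rewrite pump-< lo = refl
      ... | inj₂ hi rewrite pump-≥ hi =
        before (j ∸ d) hi (subst (j ∸ d <_) k+d∸d (∸-monoˡ-< lt (≤-trans (m≤n+m d a) le′)))

  module _ {n} {A : PTA n} {t : Tree n} {σ : Fin n}
           (teeth : ∀ i j q → Acc A q (sub t (tooth i)) → Acc A q (sub t (tooth j))) where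

    -- The data that pumping preserves. On the teeth it records acceptance instead of a run, since
    -- pumping moves states to other teeth and `teeth` then supplies a new run.
    record Spinal (p q : ℕ → Fin (m A)) : Set where
      field
        steps : ∀ i → δ A (p i) σ (p (suc i)) (q i) ≡ true
        par   : ParityAccepts (λ i → color A (p i))
        loop  : p a ≡ p (a + d)
        inner : ∀ i → Acc A (q i) (sub t (tooth i))
    open Spinal public

    pump-spinal : ∀ {p q} → Spinal p q → Spinal (p ∘ pump) (q ∘ pump)
    pump-spinal {p} {q} S = record { steps = steps′ ; par = par′ ; loop = loop′ ; inner = inner′ }
      where
      a+d∸d : ∀ i → i + (a + d) ∸ d ≡ i + a
      a+d∸d i = trans (cong (_∸ d) (sym (+-assoc i a d))) (m+n∸n≡m (i + a) d)
      steps′ : ∀ i → δ A (p (pump i)) σ (p (pump (suc i))) (q (pump i)) ≡ true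
      steps′ i with <-≤-connex i (a + d)
      ... | inj₂ hi rewrite pump-≥ hi | pump-≥ (m≤n⇒m≤1+n hi)
                          | +-∸-assoc 1 (≤-trans (m≤n+m d a) hi) = steps S (i ∸ d)
      ... | inj₁ lo rewrite pump-< lo with m≤n⇒m<n∨m≡n lo
      ...   | inj₁ lo′ rewrite pump-< lo′ = steps S i
      -- The step that closes the loop: position `a + d` is read as `a`, where the state is the same
      -- by `loop`.
      ...   | inj₂ si≡ rewrite pump-≥ (≤-reflexive (sym si≡)) =
        subst (λ x → δ A (p i) σ x (q i) ≡ true)
          (trans (cong p si≡) (trans (sym (loop S))
            (cong p (sym (trans (cong (_∸ d) si≡) (a+d∸d 0))))))
          (steps S i)
      par′ : ParityAccepts (λ i → color A (p (pump i)))
      par′ = parity-unshift (a + d)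
        (parity-cong (λ i → cong (λ x → color A (p x))
            (sym (trans (pump-≥ (m≤n+m (a + d) i)) (a+d∸d i))))
          (parity-shift a (par S)))
      loop′ : p (pump a) ≡ p (pump (a + d))
      loop′ rewrite pump-< a<a+d | pump-≥ (≤-refl {a + d}) | a+d∸d 0 = refl
      inner′ : ∀ i → Acc A (q (pump i)) (sub t (tooth i))
      inner′ i = teeth (pump i) i _ (inner S (pump i))

    pumps : (ℕ → Fin (m A)) → ℕ → ℕ → Fin (m A)
    pumps p zero    = p
    pumps p (suc n) = pumps p n ∘ pump

    pumps-spinal : ∀ {p q} → Spinal p q → ∀ n → Spinal (pumps p n) (pumps q n)
    pumps-spinal S zero    = S
    pumps-spinal S (suc n) = pump-spinal (pumps-spinal S n)

    pumps-deviation : ∀ {p k} → FirstDeviation p k → ∀ n → FirstDeviation (pumps p n) (k + n * d)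
    pumps-deviation {p} {k} D zero    = subst (FirstDeviation p) (sym (+-identityʳ k)) D
    pumps-deviation {p} {k} D (suc n) = subst (FirstDeviation (pumps p (suc n)))
      (trans (+-assoc k (n * d) d) (cong (k +_) (+-comm (n * d) d)))
      (deviation-pump (pumps-deviation D n))

    pumps-0 : ∀ p n → pumps p n 0 ≡ p 0
    pumps-0 p zero    = refl
    pumps-0 p (suc n) = trans (cong (pumps p n) (pump-< (≤-<-trans z≤n a<a+d))) (pumps-0 p n)

    infinite-pump : ExcludedMiddle 0ℓ → (∀ i → t (spine i) ≡ σ) →
                    ∀ {p q} → Spinal p q → ∃[ k ] (a + d ≤ k × p k ≢ p (k ∸ d)) →
                    Infinite A (p 0) t
    infinite-pump em labels {p} {q} S dev = φs , runs , distinct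
      where
      k = proj₁ (least em _ dev)
      D : FirstDeviation p k
      D with least em _ dev
      ... | k , (le , ne) , min =
        le , ne , λ j le′ lt → decidable-stable (p j Fin.≟ p (j ∸ d)) λ ne′ → min j lt (le′ , ne′)
      toothRun : ℕ → ℕ → Labeling A
      toothRun n i = proj₁ (inner (pumps-spinal S n) i)
      φs : ℕ → Labeling A
      φs n = comb (pumps p n) (toothRun n)
      runs : ∀ n → Run A (p 0) t (φs n)
      runs n = run-root (pumps-0 p n)
        (comb-run em t (pumps p n) (pumps q n) (toothRun n)
          (λ i → subst (λ x → δ A (pumps p n i) x (pumps p n (suc i)) (pumps q n i) ≡ true)
                   (sym (labels i)) (steps (pumps-spinal S n) i))
          (par (pumps-spinal S n))
          (λ i → proj₂ (inner (pumps-spinal S n) i)))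
      apart : ∀ {i j} → i < j → ¬ (∀ x → pumps p i x ≡ pumps p j x)
      apart {i} {j} i<j eq = deviation-unique eq (pumps-deviation D i) (pumps-deviation D j)
        (+-monoʳ-< k (*-monoˡ-< d {{>-nonZero 0<d}} i<j))
      on-spine : ∀ i j → (∀ v → φs i v ≡ φs j v) → ∀ x → pumps p i x ≡ pumps p j x
      on-spine i j eq x =
        trans (sym (comb-spine (pumps p i) (toothRun i) x))
          (trans (eq (spine x)) (comb-spine (pumps p j) (toothRun j) x))
      distinct : ∀ i j → i ≢ j → ¬ (∀ v → φs i v ≡ φs j v)
      distinct i j i≢j eq with <-cmp i j
      ... | tri< i<j _ _ = apart i<j (on-spine i j eq)
      ... | tri≈ _ i≡j _ = i≢j i≡j
      ... | tri> _ _ j<i = apart j<i (on-spine j i (λ v → sym (eq v)))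

-- The tower of combs

-- A shape (j , i) is the i-th spine node of a comb of rank j; rank 0 stands for the all-1F tree.
-- A comb of rank 1 + j has the top rank M on its first N teeth and rank j on all later ones.
module Tower (M N : ℕ) where

  Shape : Set
  Shape = ℕ × ℕ

  exit : ℕ → ℕ → ℕ
  exit j i = if does (i <? N) then M else j

  move : Dir → Shape → Shape
  move l (j     , i) = j , suc i
  move r (zero  , i) = 0 , 0
  move r (suc j , i) = exit j i , 0

  shape : Shape → Node → Shape
  shape = foldr move

  label : Shape → Fin 2
  label (zero  , _) = 1F
  label (suc _ , _) = 0F

  tower : Shape → Tree 2
  tower s v = label (shape s v)

  T : ℕ → Tree 2
  T j = tower (j , 0)

  shape-++ : ∀ s w v → shape s (w ++ v) ≡ shape (shape s v) w
  shape-++ s w v = foldr-++ move s w v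

  sub-tower : ∀ s v w → sub (tower s) v w ≡ tower (shape s v) w
  sub-tower s v w = cong label (shape-++ s w v)

  shape-spine : ∀ j i → shape (j , 0) (spine i) ≡ (j , i)
  shape-spine j zero    = refl
  shape-spine j (suc i) = cong (move l) (shape-spine j i)

  shape-tooth : ∀ j i → shape (suc j , 0) (tooth i) ≡ (exit j i , 0)
  shape-tooth j i = cong (move r) (shape-spine (suc j) i)

  exit-< : ∀ j {i} → i < N → exit j i ≡ M
  exit-< j {i} lt rewrite dec-true (i <? N) lt = refl

  exit-≥ : ∀ j {i} → N ≤ i → exit j i ≡ j
  exit-≥ j {i} le rewrite dec-false (i <? N) (≤⇒≯ le) = refl

  exit-cases : ∀ j i → exit j i ≡ M ⊎ exit j i ≡ j
  exit-cases j i with <-≤-connex i N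
  ... | inj₁ lt = inj₁ (exit-< j lt)
  ... | inj₂ le = inj₂ (exit-≥ j le)

  T-spine : ∀ j i → T (suc j) (spine i) ≡ 0F
  T-spine j i = cong label (shape-spine (suc j) i)

  T-tooth : ∀ j i w → sub (T (suc j)) (tooth i) w ≡ T (exit j i) w
  T-tooth j i w = trans (sub-tower _ (tooth i) w) (cong (λ s → tower s w) (shape-tooth j i))

  T-has-1 : ∀ j → ∃[ v ] (T j v ≡ 1F)
  T-has-1 zero    = [] , refl
  T-has-1 (suc j) with T-has-1 j
  ... | v , e = v ++ tooth N , trans (T-tooth j N v) (trans (cong (λ k → T k v) (exit-≥ j ≤-refl)) e)

  module Types (em : ExcludedMiddle 0ℓ) (A : PTA 2) where

    P : ℕ → Fin (m A) → Set
    P j q = Acc A q (T j)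

    -- A run on a comb depends on a tooth only through the state at its root. The spine of the run
    -- is kept, the first `N` teeth agree in both combs, and the later ones are exchanged by `imp`.
    P-suc : ∀ {j j′} → (∀ q → P j q → P j′ q) → ∀ q → P (suc j) q → P (suc j′) q
    P-suc {j} {j′} imp q (φ , ρ) = _ , run-root (root ρ)
      (comb-run em (T (suc j′)) (λ i → φ (spine i)) (λ i → φ (tooth i)) (λ i → proj₁ (inner i))
        (λ i → trans (cong (λ a → δ A (φ (spine i)) a (φ (spine (suc i))) (φ (tooth i)))
                       (trans (T-spine j′ i) (sym (T-spine j i))))
                 (step ρ (spine i)))
        (spine-accept ρ) (λ i → proj₂ (inner i)))
      where
      imp′ : ∀ i q → P (exit j i) q → P (exit j′ i) q
      imp′ i q x with <-≤-connex i N
      ... | inj₁ lt rewrite exit-< j lt | exit-< j′ lt = x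
      ... | inj₂ le rewrite exit-≥ j le | exit-≥ j′ le = imp q x
      inner : ∀ i → Acc A (φ (tooth i)) (sub (T (suc j′)) (tooth i))
      inner i = acc-tree (λ w → sym (T-tooth j′ i w))
        (imp′ i _ (acc-tree (T-tooth j i) (_ , subrun ρ (tooth i))))

    P-+ : ∀ {j j′} → (∀ q → P j q → P j′ q) → ∀ k q → P (k + j) q → P (k + j′) q
    P-+ imp zero    = imp
    P-+ imp (suc k) = P-suc (P-+ imp k)

    -- The set of states accepting rank `j` as a characteristic function, which `funToFin` codes by
    -- one of `2 ^ m A` numbers.
    charP : ℕ → Fin (m A) → Fin 2
    charP j q = if does (em {P j q}) then 1F else 0F

    charP-⇒ : ∀ {j j′ q} → charP j q ≡ charP j′ q → P j q → P j′ q
    charP-⇒ {j} {j′} {q} e x with em {P j q} | em {P j′ q}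
    charP-⇒ e  x | yes _  | yes x′ = x′
    charP-⇒ () x | yes _  | no  _
    charP-⇒ e  x | no  ¬x | _      = contradiction x ¬x

    code-⇒ : ∀ j j′ → funToFin (charP j) ≡ funToFin (charP j′) → ∀ q → P j q → P j′ q
    code-⇒ j j′ e q = charP-⇒ (trans (sym (Fin.finToFun-funToFin (charP j) q))
      (trans (cong (λ c → finToFun c q) e) (Fin.finToFun-funToFin (charP j′) q)))

    -- P (1 + j) is a function of P j, so the sequence of the P j has entered its cycle by rank M.
    top-repeats : M ≡ 2 ^ m A →
                  ∃[ z ] (z < M × (∀ q → P z q → P M q) × (∀ q → P M q → P z q))
    top-repeats refl with Fin.pigeonhole (n<1+n M) (λ i → funToFin (charP (toℕ i)))
    ... | i , j , i<j , e =
      k + toℕ i , subst (k + toℕ i <_) k+j (+-monoʳ-< k i<j) ,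
      (λ q x → subst (λ j → P j q) k+j (P-+ (code-⇒ _ _ e) k q x)) ,
      (λ q x → P-+ (code-⇒ _ _ (sym e)) k q (subst (λ j → P j q) (sym k+j) x))
      where
      -- Raising both ranks by `k` keeps their types equal and brings the larger one to exactly `M`.
      k = M ∸ toℕ j
      k+j : k + toℕ j ≡ M
      k+j = m∸n+n≡m (s≤s⁻¹ (Fin.toℕ<n j))

-- Comparing color sequences block by block; branches as limits of nodes

module Blocks (e : ℕ → ℕ) (e0 : e 0 ≡ 0) (inc : ∀ k → e k < e (suc k)) where

  block-mono : ∀ {j k} → j ≤ k → e j ≤ e k
  block-mono {j} {k} j≤k with ≤⇒≤′ j≤k
  ... | ≤′-refl      = ≤-refl
  ... | ≤′-step j≤′k = ≤-trans (block-mono (≤′⇒≤ j≤′k)) (<⇒≤ (inc _))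

  k≤e : ∀ k → k ≤ e k
  k≤e zero    = z≤n
  k≤e (suc k) = ≤-<-trans (k≤e k) (inc k)

  find : ∀ t → ∃[ k ] (e k ≤ t × t < e (suc k))
  find zero = 0 , ≤-reflexive e0 , subst (_< e 1) e0 (inc 0)
  find (suc t) with find t
  ... | k , lo , hi with m≤n⇒m<n∨m≡n hi
  ...   | inj₁ lt = k , m≤n⇒m≤1+n lo , lt
  ...   | inj₂ eq = suc k , ≤-reflexive (sym eq) , subst (_< e (suc (suc k))) (sym eq) (inc (suc k))

  late : ∀ {j k t} → e j ≤ t → t < e (suc k) → j ≤ k
  late {j} {k} lo hi = ≮⇒≥ λ k<j → <⇒≱ hi (≤-trans (block-mono k<j) lo)

Within : (ℕ → ℕ) → ℕ → ℕ → Set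
Within e k t = e k ≤ t × t < e (suc k)

-- Corresponding blocks show the same set of colors; their lengths and the order within them may
-- differ, since parity only depends on which colors occur in arbitrarily late blocks.
parity-blocks : ∀ {c c′} (e f : ℕ → ℕ) → e 0 ≡ 0 → f 0 ≡ 0 →
  (∀ k → e k < e (suc k)) → (∀ k → f k < f (suc k)) →
  (∀ k t → Within e k t → ∃[ t′ ] (Within f k t′ × c t ≡ c′ t′)) →
  (∀ k t′ → Within f k t′ → ∃[ t ] (Within e k t × c t ≡ c′ t′)) →
  ParityAccepts c′ → ParityAccepts c
parity-blocks {c} {c′} e f e0 f0 inc-e inc-f to from (h , even , inf , K , bound) =
  h , even , inf′ , e K , bound′
  where
  module E = Blocks e e0 inc-e
  module F = Blocks f f0 inc-f
  inf′ : ∀ j → ∃[ i ] (j ≤ i × c i ≡ h)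
  inf′ j with inf (f j)
  ... | t′ , fj≤t′ , ct′ with F.find t′
  ...   | k , w with from k t′ w
  ...     | t , (ek≤t , _) , ct =
    t , ≤-trans (E.k≤e j) (≤-trans (E.block-mono (F.late fj≤t′ (proj₂ w))) ek≤t) , trans ct ct′
  bound′ : ∀ i → e K ≤ i → c i ≤ h
  bound′ t eK≤t with E.find t
  ... | k , w with to k t w
  ...   | t′ , (fk≤t′ , _) , ct =
    subst (_≤ h) (sym ct)
      (bound t′ (≤-trans (F.k≤e K) (≤-trans (F.block-mono (E.late eK≤t (proj₂ w))) fk≤t′)))

-- Depth counts from the root while the list begins with the deepest edge, hence `d` sits at depth
-- `length v`. Beyond the node the value defaults to `l`.
dirAt : Node → ℕ → Dir
dirAt []      j = l
dirAt (d ∷ v) j = if does (j ≟ length v) then d else dirAt v j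

dirAt-last : ∀ d v → dirAt (d ∷ v) (length v) ≡ d
dirAt-last d v rewrite dec-true (length v ≟ length v) refl = refl

dirAt-∷ : ∀ d v {j} → j < length v → dirAt (d ∷ v) j ≡ dirAt v j
dirAt-∷ d v {j} lt rewrite dec-false (j ≟ length v) (<⇒≢ lt) = refl

dirAt-++ : ∀ u v {j} → j < length v → dirAt (u ++ v) j ≡ dirAt v j
dirAt-++ []      v lt = refl
dirAt-++ (d ∷ u) v {j} lt = trans
  (dirAt-∷ d (u ++ v) (≤-trans lt (subst (length v ≤_) (sym (length-++ u)) (m≤n+m _ _))))
  (dirAt-++ u v lt)

branch-dirAt : ∀ b v → (∀ j → j < length v → b j ≡ dirAt v j) → branchNode b (length v) ≡ v
branch-dirAt b []      eq = refl
branch-dirAt b (d ∷ v) eq = cong₂ _∷_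
  (trans (eq (length v) ≤-refl) (dirAt-last d v))
  (branch-dirAt b v (λ j lt → trans (eq j (m≤n⇒m≤1+n lt)) (dirAt-∷ d v lt)))

-- A strictly descending chain of nodes determines a branch through all of them; its direction at
-- depth `j` is already fixed by `s (suc j)`, whose length exceeds `j`.
module Limit (s : ℕ → Node) (w : ℕ → Node) (chain : ∀ k → s (suc k) ≡ w k ++ s k)
             (grows : ∀ k → length (s k) < length (s (suc k))) where

  limit : ℕ → Dir
  limit j = dirAt (s (suc j)) j

  long : ∀ k → k ≤ length (s k)
  long zero    = z≤n
  long (suc k) = ≤-<-trans (long k) (grows k)

  extends : ∀ {j k} → j ≤′ k → ∃[ u ] (s k ≡ u ++ s j)
  extends ≤′-refl = [] , refl
  extends {j} {suc k} (≤′-step le) with extends le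
  ... | u , eq = w k ++ u , trans (chain k) (trans (cong (w k ++_) eq) (sym (++-assoc (w k) u (s j))))

  limit-dirAt : ∀ k j → j < length (s k) → limit j ≡ dirAt (s k) j
  limit-dirAt k j lt with ≤-total (suc j) k
  ... | inj₁ le with extends (≤⇒≤′ le)
  ...   | u , eq = sym (trans (cong (λ x → dirAt x j) eq) (dirAt-++ u (s (suc j)) (long (suc j))))
  limit-dirAt k j lt | inj₂ le with extends (≤⇒≤′ le)
  ...   | u , eq = trans (cong (λ x → dirAt x j) eq) (dirAt-++ u (s k) lt)

  limit-through : ∀ k u v → s k ≡ u ++ v → branchNode limit (length v) ≡ v
  limit-through k u v eq = branch-dirAt limit v λ j lt →
    trans (limit-dirAt k j (subst (λ x → j < length x) (sym eq)
             (≤-trans lt (subst (length v ≤_) (sym (length-++ u)) (m≤n+m _ _)))))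
      (trans (cong (λ x → dirAt x j) eq) (dirAt-++ u v lt))

-- The decoy: infinitely many runs on the tower

blank : Tree 2
blank _ = 0F

module Key (em : ExcludedMiddle 0ℓ) (A : PTA 2) where

  -- `M` bounds the number of sets of states, so some rank below `M` has the type of rank `M`. `N`
  -- leaves room for a loop that ends by position `m A` and for one further period of it.
  M = 2 ^ m A
  N = m A + m A
  open Tower M N public
  open Types em A public

  z       = proj₁ (top-repeats refl)
  z<M     = proj₁ (proj₂ (top-repeats refl))
  Pz⇒PM   = proj₁ (proj₂ (proj₂ (top-repeats refl)))
  PM⇒Pz   = proj₂ (proj₂ (proj₂ (top-repeats refl)))

  module _ {q φ} (ρ : Run A q (T M) φ) where

    Φ : Node → ℕ → Fin (m A)
    Φ s i = φ (spine i ++ s)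

    -- The combs of rank `1 + z` inside the tower: their teeth have rank `M` or `z`, which the
    -- automaton cannot tell apart.
    Homogeneous : Node → Set
    Homogeneous s = shape (M , 0) s ≡ (suc z , 0)

    private
      repeat : ∀ s → ∃[ i ] ∃[ j ] (i Fin.< j × Φ s (toℕ i) ≡ Φ s (toℕ j))
      repeat s = Fin.pigeonhole (n<1+n (m A)) (λ i → Φ s (toℕ i))

    opaque
      -- Start and length of a loop that the pigeonhole principle finds among the first `m A + 1`
      -- spine states below the node.
      a d : Node → ℕ
      a s = toℕ (proj₁ (repeat s))
      d s = toℕ (proj₁ (proj₂ (repeat s))) ∸ a s

      0<d : ∀ s → 0 < d s
      0<d s = m<n⇒0<n∸m (proj₁ (proj₂ (proj₂ (repeat s))))

      a+d≤m : ∀ s → a s + d s ≤ m A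
      a+d≤m s = subst (_≤ m A) (sym (m+[n∸m]≡n (<⇒≤ (proj₁ (proj₂ (proj₂ (repeat s)))))))
                  (s≤s⁻¹ (Fin.toℕ<n (proj₁ (proj₂ (repeat s)))))

      Φ-loop : ∀ s → Φ s (a s) ≡ Φ s (a s + d s)
      Φ-loop s = trans (proj₂ (proj₂ (proj₂ (repeat s))))
        (cong (Φ s) (sym (m+[n∸m]≡n (<⇒≤ (proj₁ (proj₂ (proj₂ (repeat s))))))))

    Deviates : Node → Set
    Deviates s = ∃[ k ] (a s + d s ≤ k × Φ s k ≢ Φ s (k ∸ d s))

    infinite-deviation : ∀ s → Homogeneous s → Deviates s → Infinite A q (T M)
    infinite-deviation s hom dev = infinite-above em ρ s
      (infinite-pump {A = A} {sub (T M) s} {0F} teeth em labels S dev)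
      where
      open Pump (a s) (d s) (0<d s)
      local : ∀ v → sub (T M) s v ≡ T (suc z) v
      local v = trans (sub-tower (M , 0) s v) (cong (λ x → tower x v) hom)
      labels : ∀ i → sub (T M) s (spine i) ≡ 0F
      labels i = trans (local (spine i)) (T-spine z i)
      local-tooth : ∀ i v → sub (sub (T M) s) (tooth i) v ≡ T (exit z i) v
      local-tooth i v = trans (local (v ++ tooth i)) (T-tooth z i v)
      -- Each tooth has rank `M` or `z`, and both ranks are accepted from the same states; `M`
      -- serves as the intermediate rank for moving from tooth to tooth.
      fromM : ∀ i q → P M q → P (exit z i) q
      fromM i q x with exit-cases z i
      ... | inj₁ e rewrite e = x
      ... | inj₂ e rewrite e = PM⇒Pz q x
      toM : ∀ i q → P (exit z i) q → P M q
      toM i q x with exit-cases z i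
      ... | inj₁ e rewrite e = x
      ... | inj₂ e rewrite e = Pz⇒PM q x
      teeth : ∀ i j q → Acc A q (sub (sub (T M) s) (tooth i)) → Acc A q (sub (sub (T M) s) (tooth j))
      teeth i j q x = acc-tree (λ v → sym (local-tooth j v))
        (fromM j q (toM i q (acc-tree (local-tooth i) x)))
      S : Spinal {A = A} {sub (T M) s} {0F} teeth (Φ s) (λ i → φ (tooth i ++ s))
      S = record
        { steps = λ i → subst (λ x → δ A (Φ s i) x (Φ s (suc i)) (φ (tooth i ++ s)) ≡ true)
                          (labels i) (step ρ (spine i ++ s))
        ; par   = spine-accept (subrun ρ s)
        ; loop  = Φ-loop s
        ; inner = λ i → _ , subrun (subrun ρ s) (tooth i)
        }

    -- Without deviations, the run on the tower folds onto the blank tree: on homogeneous combs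
    -- position a + 2d ≤ N is identified with a + d, so they are only left through their first N teeth.
    module Folding (periodic : ∀ s → Homogeneous s → ∀ k → a s + d s ≤ k → Φ s k ≡ Φ s (k ∸ d s)) where

      bound : Node → ℕ
      bound s = a s + d s + d s

      bound≤N : ∀ s → bound s ≤ N
      bound≤N s = +-mono-≤ (a+d≤m s) (≤-trans (m≤n+m (d s) (a s)) (a+d≤m s))

      a+d<bound : ∀ s → a s + d s < bound s
      a+d<bound s = m<m+n (a s + d s) (0<d s)

      data Folded (s : Node) (i : ℕ) : ℕ → Set where
        kept   : ¬ (Homogeneous s × i ≡ bound s) → Folded s i i
        folded : Homogeneous s → i ≡ bound s → Folded s i (a s + d s)

      fold : Node → ℕ → ℕ
      fold s i = if does (em {Homogeneous s × i ≡ bound s}) then a s + d s else i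

      fold-view : ∀ s i → Folded s i (fold s i)
      fold-view s i with em {Homogeneous s × i ≡ bound s}
      ... | yes (hom , eq) = folded hom eq
      ... | no  ¬p         = kept ¬p

      Φ-periodic : ∀ s → Homogeneous s → ∀ i → a s ≤ i → Φ s (i + d s) ≡ Φ s i
      Φ-periodic s hom i le = trans (periodic s hom (i + d s) (+-monoˡ-≤ (d s) le))
        (cong (Φ s) (m+n∸n≡m i (d s)))

      -- Folding goes back by one period inside the periodic part of the spine, so not only the
      -- current state but the whole remaining spine is unchanged.
      Φ-fold : ∀ s i e → Φ s (fold s i + e) ≡ Φ s (i + e)
      Φ-fold s i e with fold s i | fold-view s i
      ... | _ | kept _          = refl
      ... | _ | folded hom refl = sym (trans (cong (Φ s) swap)
        (Φ-periodic s hom (a s + d s + e) (≤-trans (m≤m+n (a s) (d s)) (m≤m+n (a s + d s) e))))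
        where
        swap : bound s + e ≡ a s + d s + e + d s
        swap = trans (+-assoc (a s + d s) (d s) e)
                 (trans (cong (a s + d s +_) (+-comm (d s) e)) (sym (+-assoc (a s + d s) e (d s))))

      -- Where in the tower the folded run takes its state from: the root of the current comb and
      -- the index on its spine. A right turn enters the comb hanging there.
      track : Node → Node × ℕ
      track []      = [] , 0
      track (l ∷ v) = let s , i = track v in s , fold s (suc i)
      track (r ∷ v) = let s , i = track v in tooth i ++ s , 0

      at : Node × ℕ → Node
      at (s , i) = spine i ++ s

      ψ : Labeling A
      ψ v = φ (at (track v))

      -- The invariant that keeps the folded run on labels 0F: the rank is `1 + j` with `z ≤ j`. At
      -- `j ≡ z` the index is below `bound s`, hence below `N`, so the next right turn leads back to
      -- rank `M` instead of down to `z`.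
      Safe : Node × ℕ → Set
      Safe (s , i) = ∃[ j ] (shape (M , 0) s ≡ (suc j , 0) × z ≤ j × j < M × (j ≡ z → i < bound s))

      safe-top : ∀ {s} → shape (M , 0) s ≡ (M , 0) → Safe (s , 0)
      safe-top {s} e = pred M , trans e (cong (_, 0) (sym sucM)) , s≤s⁻¹ (subst (z <_) (sym sucM) z<M) ,
        ≤-reflexive sucM , λ _ → ≤-<-trans z≤n (a+d<bound s)
        where
        sucM : suc (pred M) ≡ M
        sucM = suc-pred M {{>-nonZero (≤-<-trans z≤n z<M)}}

      shape-at : ∀ {s j} i → shape (M , 0) s ≡ (j , 0) → shape (M , 0) (spine i ++ s) ≡ (j , i)
      shape-at {s} {j} i e = trans (shape-++ (M , 0) (spine i) s)
        (trans (cong (λ x → shape x (spine i)) e) (shape-spine j i))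

      track-safe : ∀ v → Safe (track v)
      track-safe [] = safe-top refl
      track-safe (l ∷ v) with track v | track-safe v
      ... | s , i | j , e , z≤j , j<M , lt = j , e , z≤j , j<M , lt′
        where
        lt′ : j ≡ z → fold s (suc i) < bound s
        lt′ refl with fold s (suc i) | fold-view s (suc i)
        ... | _ | kept ¬p    = ≤∧≢⇒< (lt refl) λ eq → ¬p (e , eq)
        ... | _ | folded _ _ = a+d<bound s
      track-safe (r ∷ v) with track v | track-safe v
      ... | s , i | j , e , z≤j , j<M , lt with cong (move r) (shape-at i e)
      ...   | e′ with m≤n⇒m<n∨m≡n z≤j
      ...     | inj₂ refl = safe-top (trans e′ (cong (_, 0) (exit-< z (<-≤-trans (lt refl) (bound≤N s)))))
      ...     | inj₁ z<j with exit-cases j i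
      ...       | inj₁ eM = safe-top (trans e′ (cong (_, 0) eM))
      ...       | inj₂ ej = pred j , trans e′ (cong (_, 0) (trans ej (sym sucj))) ,
        s≤s⁻¹ (subst (z <_) (sym sucj) z<j) , ≤-trans (≤-reflexive sucj) (<⇒≤ j<M) ,
        λ _ → ≤-<-trans z≤n (a+d<bound (tooth i ++ s))
        where
        sucj : suc (pred j) ≡ j
        sucj = suc-pred j {{>-nonZero (≤-<-trans z≤n z<j)}}

      blank-at : ∀ v → T M (at (track v)) ≡ 0F
      blank-at v with track v | track-safe v
      ... | s , i | j , e , _ = cong label (shape-at i e)

      ψ-step : ∀ v → δ A (ψ v) 0F (ψ (l ∷ v)) (ψ (r ∷ v)) ≡ true
      ψ-step v = subst₂ (λ x y → δ A (ψ v) x y (ψ (r ∷ v)) ≡ true)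
        (blank-at v) (sym turn) (step ρ (at (track v)))
        where
        turn : ψ (l ∷ v) ≡ φ (l ∷ at (track v))
        turn with track v
        ... | s , i = trans (cong (Φ s) (sym (+-identityʳ _)))
                        (trans (Φ-fold s (suc i) 0) (cong (Φ s) (+-identityʳ _)))

      module _ (β : ℕ → Dir) where

        tk : ℕ → Node × ℕ
        tk t = track (branchNode β t)

        κ : ℕ → ℕ
        κ t = color A (φ (at (tk t)))

        tk-l : ∀ {t s i} → tk t ≡ (s , i) → β t ≡ l → tk (suc t) ≡ (s , fold s (suc i))
        tk-l {t} e eq rewrite eq | e = refl

        tk-r : ∀ {t s i} → tk t ≡ (s , i) → β t ≡ r → tk (suc t) ≡ (tooth i ++ s , 0)
        tk-r {t} e eq rewrite eq | e = refl

        -- On a branch that finally stays on one spine, folding changes the indices but not the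
        -- states, which are those of the original spine from `i₀` on.
        eventually-left : ∀ k → (∀ t → k ≤ t → β t ≡ l) → ParityAccepts κ
        eventually-left k left = parity-unshift k
          (parity-cong (λ n → cong (color A) (sym (same n)))
            (parity-shift i₀ (spine-accept (subrun ρ s₀))))
          where
          s₀ = proj₁ (tk k)
          i₀ = proj₂ (tk k)
          -- The invariant speaks of all continuations `e`, so that it survives the next step and
          -- the next fold.
          follow : ∀ n → ∃[ i ] (tk (n + k) ≡ (s₀ , i) × (∀ e → Φ s₀ (i + e) ≡ Φ s₀ (n + i₀ + e)))
          follow zero    = i₀ , refl , λ _ → refl
          follow (suc n) with follow n
          ... | i , e , tail = fold s₀ (suc i) , tk-l e (left (n + k) (m≤n+m k n)) ,
            λ x → trans (Φ-fold s₀ (suc i) x)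
                    (trans (cong (Φ s₀) (sym (+-suc i x)))
                      (trans (tail (suc x)) (cong (Φ s₀) (+-suc (n + i₀) x))))
          same : ∀ n → φ (at (tk (n + k))) ≡ Φ s₀ (n + i₀)
          same n with follow n
          ... | i , e , tail = trans (cong (λ x → φ (at x)) e)
            (trans (cong (Φ s₀) (sym (+-identityʳ i)))
              (trans (tail 0) (cong (Φ s₀) (+-identityʳ (n + i₀)))))

        module _ (right : ∀ k → ∃[ t ] (k ≤ t × β t ≡ r)) where

          next : ∀ k → ∃[ t ] (k ≤ t × β t ≡ r × (∀ j → k ≤ j → j < t → β j ≡ l))
          next k with least em (λ t → k ≤ t × β t ≡ r) (right k)
          ... | t , (le , e) , min = t , le , e , λ j k≤j j<t → left (β j) (λ e′ → min j j<t (k≤j , e′))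
            where
            left : ∀ d → d ≢ r → d ≡ l
            left l _  = refl
            left r ne = contradiction refl ne

          -- The colors seen on an initial part of a comb are the same on the folded and on the
          -- original spine, because a full period of the loop precedes the folding point.
          segment : ∀ {e s} n → tk e ≡ (s , 0) → (∀ j → e ≤ j → j < n + e → β j ≡ l) →
            ∃[ i ] (tk (n + e) ≡ (s , i) ×
              (∀ k → k ≤ i → ∃[ t ] (t ≤ n × κ (t + e) ≡ color A (Φ s k))) ×
              (∀ t → t ≤ n → ∃[ k ] (k ≤ i × κ (t + e) ≡ color A (Φ s k))))
          segment zero start left = 0 , start ,
            (λ { zero z≤n → 0 , z≤n , cong (λ x → color A (φ (at x))) start }) ,
            (λ { zero z≤n → 0 , z≤n , cong (λ x → color A (φ (at x))) start })
          segment {e} {s} (suc n) start left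
            with segment n start (λ j le lt → left j le (m≤n⇒m≤1+n lt))
          ... | i , here , cover , hit
            with fold s (suc i) | fold-view s (suc i) | tk-l here (left (n + e) (m≤n+m e n) ≤-refl)
          ... | _ | kept _ | here′ = suc i , here′ , cover′ , hit′
            where
            new : κ (suc n + e) ≡ color A (Φ s (suc i))
            new = cong (λ x → color A (φ (at x))) here′
            cover′ : ∀ k → k ≤ suc i → ∃[ t ] (t ≤ suc n × κ (t + e) ≡ color A (Φ s k))
            cover′ k le with m≤n⇒m<n∨m≡n le
            ... | inj₁ lt = let t , t≤n , eq = cover k (s≤s⁻¹ lt) in t , m≤n⇒m≤1+n t≤n , eq
            ... | inj₂ refl = suc n , ≤-refl , new
            hit′ : ∀ t → t ≤ suc n → ∃[ k ] (k ≤ suc i × κ (t + e) ≡ color A (Φ s k))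
            hit′ t le with m≤n⇒m<n∨m≡n le
            ... | inj₁ lt = let k , k≤i , eq = hit t (s≤s⁻¹ lt) in k , m≤n⇒m≤1+n k≤i , eq
            ... | inj₂ refl = suc i , ≤-refl , new
          ... | _ | folded hom top | here′ = a s + d s , here′ , cover′ , hit′
            where
            new : κ (suc n + e) ≡ color A (Φ s (a s + d s))
            new = cong (λ x → color A (φ (at x))) here′
            cover′ : ∀ k → k ≤ a s + d s → ∃[ t ] (t ≤ suc n × κ (t + e) ≡ color A (Φ s k))
            -- All positions up to `a s + d s` were visited before the fold, so their earlier times
            -- still serve.
            cover′ k le =
              let t , t≤n , eq = cover k (≤-trans le (s≤s⁻¹ (subst (a s + d s <_) (sym top) (a+d<bound s))))
              in t , m≤n⇒m≤1+n t≤n , eq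
            hit′ : ∀ t → t ≤ suc n → ∃[ k ] (k ≤ a s + d s × κ (t + e) ≡ color A (Φ s k))
            hit′ t le with m≤n⇒m<n∨m≡n le
            ... | inj₂ refl = a s + d s , ≤-refl , new
            ... | inj₁ lt with hit t (s≤s⁻¹ lt)
            ...   | k , k≤i , eq with ≤-<-connex k (a s + d s)
            ...     | inj₁ lo = k , lo , eq
            -- A color seen beyond the folding target also occurs one period earlier, which is
            -- within the new range.
            ...     | inj₂ hi = k ∸ d s ,
              ≤-trans (∸-monoˡ-≤ (d s) (≤-trans k≤i (≤-trans (n≤1+n i) (≤-reflexive top))))
                (≤-reflexive (m+n∸n≡m (a s + d s) (d s))) ,
              trans eq (cong (color A) (periodic s hom k (<⇒≤ hi)))

          record Root : Set where
            constructor _at_by_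
            field
              node  : Node
              time  : ℕ
              start : tk time ≡ (node , 0)
          open Root

          module _ (R : Root) where
            stop : ℕ
            stop = proj₁ (next (time R))

            steps-left : ℕ
            steps-left = stop ∸ time R

            stop-eq : steps-left + time R ≡ stop
            stop-eq = m∸n+n≡m (proj₁ (proj₂ (next (time R))))

            seg : _
            seg = segment steps-left (start R) (λ j le lt →
              proj₂ (proj₂ (proj₂ (next (time R)))) j le (subst (j <_) stop-eq lt))

            height : ℕ
            height = proj₁ seg

            advance : Root
            advance = (tooth height ++ node R) at suc stop by
              tk-r (trans (cong tk (sym stop-eq)) (proj₁ (proj₂ seg))) (proj₁ (proj₂ (proj₂ (next (time R)))))

          roots : ℕ → Root
          roots zero    = [] at 0 by refl
          roots (suc k) = advance (roots k)

          node-length : ∀ k → length (node (roots (suc k))) ≡ suc (height (roots k) + length (node (roots k)))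
          node-length k = cong suc (trans (length-++ (spine h)) (cong (_+ length (node (roots k))) (length-spine h)))
            where h = height (roots k)

          grows : ∀ k → length (node (roots k)) < length (node (roots (suc k)))
          grows k = subst (length (node (roots k)) <_) (sym (node-length k)) (s≤s (m≤n+m _ _))

          open Limit (λ k → node (roots k)) (λ k → tooth (height (roots k))) (λ _ → refl) grows

          κ′ : ℕ → ℕ
          κ′ t = color A (φ (branchNode limit t))

          κ′-at : ∀ k i → i ≤ height (roots k) →
                  κ′ (i + length (node (roots k))) ≡ color A (Φ (node (roots k)) i)
          κ′-at k i le = cong (λ x → color A (φ x)) (trans (cong (branchNode limit) (sym len))
            (limit-through (suc k) (r ∷ spine (h ∸ i)) (spine i ++ s)
              (cong (r ∷_) (trans (cong (λ x → spine x ++ s) (sym (m∸n+n≡m le)))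
                (trans (cong (_++ s) (spine-+ (h ∸ i) i)) (++-assoc (spine (h ∸ i)) (spine i) s))))))
            where
            s = node (roots k)
            h = height (roots k)
            len : length (spine i ++ s) ≡ i + length s
            len = trans (length-++ (spine i)) (cong (_+ length s) (length-spine i))

          -- The combs entered form a chain in the tower. Between consecutive comb roots, its limit
          -- branch shows the same colors in the original run as the folded run shows between the
          -- corresponding right turns.
          infinitely-right : ParityAccepts κ
          infinitely-right = parity-blocks {κ} {κ′} (λ k → time (roots k)) (λ k → length (node (roots k)))
            refl refl (λ k → s≤s (proj₁ (proj₂ (next (time (roots k)))))) grows to from (accept ρ limit)
            where
            to : ∀ k t → Within (λ k → time (roots k)) k t →
                 ∃[ t′ ] (Within (λ k → length (node (roots k))) k t′ × κ t ≡ κ′ t′)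
            to k t (lo , hi) with proj₂ (proj₂ (proj₂ (seg (roots k)))) (t ∸ time (roots k))
                                    (∸-monoˡ-≤ (time (roots k)) (s≤s⁻¹ hi))
            ... | i , i≤h , eq = i + length (node (roots k)) ,
              (m≤n+m _ i , subst (i + length (node (roots k)) <_) (sym (node-length k)) (s≤s (+-monoˡ-≤ _ i≤h))) ,
              trans (cong κ (sym (m∸n+n≡m lo))) (trans eq (sym (κ′-at k i i≤h)))
            from : ∀ k t′ → Within (λ k → length (node (roots k))) k t′ →
                   ∃[ t ] (Within (λ k → time (roots k)) k t × κ t ≡ κ′ t′)
            from k t′ (lo , hi) = lemma
              where
              L = length (node (roots k))
              i≤h : t′ ∸ L ≤ height (roots k)
              i≤h = ≤-trans (∸-monoˡ-≤ L (s≤s⁻¹ (subst (t′ <_) (node-length k) hi)))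
                      (≤-reflexive (m+n∸n≡m _ L))
              lemma : ∃[ t ] (Within (λ k → time (roots k)) k t × κ t ≡ κ′ t′)
              lemma with proj₁ (proj₂ (proj₂ (seg (roots k)))) (t′ ∸ L) i≤h
              ... | t , t≤n , eq = t + time (roots k) ,
                (m≤n+m _ t , s≤s (≤-trans (+-monoˡ-≤ (time (roots k)) t≤n) (≤-reflexive (stop-eq (roots k))))) ,
                trans eq (trans (sym (κ′-at k (t′ ∸ L) i≤h)) (cong κ′ (m∸n+n≡m lo)))

        ψ-accept : ParityAccepts κ
        ψ-accept with em {∃[ k ] (∀ t → k ≤ t → β t ≡ l)}
        ... | yes (k , left) = eventually-left k left
        ... | no  ¬left = infinitely-right right
          where
          right : ∀ k → ∃[ t ] (k ≤ t × β t ≡ r)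
          right k with em {∃[ t ] (k ≤ t × β t ≡ r)}
          ... | yes p = p
          ... | no ¬p = contradiction (k , λ t le → left t (β t) refl le) ¬left
            where
            left : ∀ t d → β t ≡ d → k ≤ t → β t ≡ l
            left t l e le = e
            left t r e le = contradiction (t , le , e) ¬p

      fold-run : Run A q blank ψ
      fold-run = run (root ρ) ψ-step ψ-accept

  tower-infinite : ∀ q → Acc A q (T M) → ¬ Acc A q blank → Infinite A q (T M)
  tower-infinite q (φ , ρ) ¬blank with em {∃[ s ] (Homogeneous ρ s × Deviates ρ s)}
  ... | yes (s , hom , dev) = infinite-deviation ρ s hom dev
  ... | no  none = contradiction (_ , Folding.fold-run ρ periodic) ¬blank
    where
    periodic : ∀ s → Homogeneous ρ s → ∀ k → a ρ s + d ρ s ≤ k → Φ ρ s k ≡ Φ ρ s (k ∸ d ρ s)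
    periodic s hom k le = decidable-stable (Φ ρ s k Fin.≟ Φ ρ s (k ∸ d ρ s))
      λ ne → none (s , hom , k , le , ne)

decoy : ExcludedMiddle 0ℓ → (A : PTA 2) →
        ∃[ t ] ((∃[ v ] (t v ≡ 1F)) × (∀ q → Acc A q t → ¬ Acc A q blank → Infinite A q t))
decoy em A = T M , T-has-1 M , tower-infinite
  where open Key em A

-- From infinitely many runs to lower bounds on ambiguity

parity-eventually : ∀ {c e} → 2 ∣ e → ∀ k → (∀ i → k ≤ i → c i ≡ e) → ParityAccepts c
parity-eventually {c} {e} even k const =
  e , even , (λ j → j + k , m≤m+n j k , const (j + k) (m≤n+m k j)) , k ,
  λ i le → ≤-reflexive (const i le)

parity-≢1 : ∀ {c} → ParityAccepts c → ¬ (∀ i → c i ≡ 1)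
parity-≢1 (e , even , inf , _) ones with inf 0
... | i , _ , eq with ∣1⇒≡1 (subst (2 ∣_) (trans (sym eq) (ones i)) even)
...   | ()

-- Turns a defect that every defective node passes on to a child into a branch along which it
-- persists forever.
follow : (W : Node → Set) → W [] → (∀ v → W v → ∃[ d ] W (d ∷ v)) →
         ∃[ b ] (∀ i → W (branchNode b i))
follow W W[] next = dir , λ i → subst W (sym (same i)) (proj₂ (walk i))
  where
  walk : ℕ → ∃ W
  walk zero    = [] , W[]
  walk (suc i) = let v , Wv = walk i ; d , Wdv = next v Wv in d ∷ v , Wdv
  dir : ℕ → Dir
  dir i = proj₁ (next (proj₁ (walk i)) (proj₂ (walk i)))
  same : ∀ i → branchNode dir i ≡ proj₁ (walk i)
  same zero    = refl
  same (suc i) = cong (dir i ∷_) (same i)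

update : {X : Set} → ℕ → X → (ℕ → X) → ℕ → X
update i x f j = if does (j ≟ i) then x else f j

module _ {X : Set} (x : X) (f : ℕ → X) where

  update-same : ∀ i → update i x f i ≡ x
  update-same i rewrite dec-true (i ≟ i) refl = refl

  update-other : ∀ i {j} → j ≢ i → update i x f j ≡ f j
  update-other i {j} ne rewrite dec-false (j ≟ i) ne = refl

accepting-state : ∀ {n} {B : PTA n} {t φ} → ACC B t φ → ∀ {t′ φ′} → Run B (φ []) t′ φ′ → ACC B t′ φ′
accepting-state acc = run⇒acc (proj₁ (proj₁ acc))

infinite⇒¬finite : ∀ {n} {B : PTA n} {t φ} → ACC B t φ → Infinite B (φ []) t → ¬ FinitelyAmbiguous B
infinite⇒¬finite {B = B} {t} acc (φs , runs , distinct) fin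
  with fin t
... | fs , cover = clash
  where
  rep : ∀ i → ∃[ ψ ] (ψ ∈ fs × (∀ v → ψ v ≡ φs i v))
  rep i = cover (φs i) (accepting-state acc (runs i))
  slot : ℕ → Fin (length fs)
  slot i = index (proj₁ (proj₂ (rep i)))
  at-slot : ∀ i → proj₁ (rep i) ≡ lookup fs (slot i)
  at-slot i = lookup-index (proj₁ (proj₂ (rep i)))
  clash : ⊥
  clash with Fin.pigeonhole (n<1+n (length fs)) (λ i → slot (toℕ i))
  ... | i , j , i<j , eq = distinct (toℕ i) (toℕ j) (<⇒≢ i<j) λ v →
    trans (sym (proj₂ (proj₂ (rep (toℕ i))) v))
      (trans (cong (λ ψ → ψ v) (trans (at-slot (toℕ i)) (trans (cong (lookup fs) eq) (sym (at-slot (toℕ j))))))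
        (proj₂ (proj₂ (rep (toℕ j))) v))

infinite⇒¬bounded : ∀ {n} {B : PTA n} {t φ} → ACC B t φ → Infinite B (φ []) t → ∀ k → ¬ Ambiguous≤ k B
infinite⇒¬bounded {t = t} acc (φs , runs , distinct) k amb
  with amb t (λ i → φs (toℕ i)) (λ i → accepting-state acc (runs (toℕ i)))
... | i , j , i≢j , eq = distinct (toℕ i) (toℕ j) (λ e → i≢j (Fin.toℕ-injective e)) eq

-- Keeps the spine of a computation and exchanges all teeth at once; a new tooth only has to be
-- accepted from the state at the root of the old one.
regrow : ExcludedMiddle 0ℓ → ∀ {n} {B : PTA n} {t : Tree n} {φ : Labeling B} → ACC B t φ → (t′ : Tree n) (ψs : ℕ → Labeling B) →
         (∀ i → t′ (spine i) ≡ t (spine i)) →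
         (∀ i → Run B (φ (tooth i)) (sub t′ (tooth i)) (ψs i)) →
         ACC B t′ (comb (λ i → φ (spine i)) ψs)
regrow em {B = B} {t} {φ} acc t′ ψs eq runs = accepting-state {B = B} {t} {φ} acc
  (comb-run em t′ (λ i → φ (spine i)) (λ i → φ (tooth i)) ψs
    (λ i → trans (cong (λ a → δ B (φ (spine i)) a (φ (spine (suc i))) (φ (tooth i))) (eq i))
             (step ρ (spine i)))
    (spine-accept ρ) runs)
  where
  ρ : Run B (φ []) t φ
  ρ = acc⇒run {A = B} {t} {φ} acc

-- Two runs on every tooth yield a run for every subset of ℕ, and diagonalization applies.
infinite-teeth⇒¬countable : ExcludedMiddle 0ℓ → ∀ {B : PTA 2} {y φ} →
  ACC B (comb (λ _ → 0F) (λ _ → y)) φ → (∀ i → Infinite B (φ (tooth i)) y) → ¬ CountablyAmbiguous B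
infinite-teeth⇒¬countable em {B} {y} {φ} acc choices count =
  let i , eq = proj₂ (count t) _ (regrow em {B = B} {t = t} {φ} acc t ψs (λ _ → refl) runs)
  in proj₂ (avoid i) λ w → trans (eq (w ++ tooth i)) (comb-tooth (λ i → φ (spine i)) ψs i w)
  where
  t : Tree 2
  t = comb (λ _ → 0F) (λ _ → y)
  Same : ℕ → ℕ → Set
  Same i c = ∀ w → proj₁ (count t) i (w ++ tooth i) ≡ proj₁ (choices i) c w
  avoid : ∀ i → ∃[ c ] ¬ Same i c
  avoid i with em {Same i 0}
  ... | no ¬s = 0 , ¬s
  -- The labeling enumerated at `i` cannot agree on tooth `i` with both of the distinct runs 0 and
  -- 1.
  ... | yes s = 1 , λ s′ → proj₂ (proj₂ (choices i)) 0 1 (λ ()) λ w → trans (sym (s w)) (s′ w)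
  ψs : ℕ → Labeling B
  ψs i = proj₁ (choices i) (proj₁ (avoid i))
  runs : ∀ i → Run B (φ (tooth i)) (sub t (tooth i)) (ψs i)
  runs i = run-tree (λ w → sym (comb-tooth (λ _ → 0F) (λ _ → y) i w))
    (proj₁ (proj₂ (choices i)) (proj₁ (avoid i)))

-- Automata specified by propositions over a type of states

module Build (em : ExcludedMiddle 0ℓ) {n : ℕ} {St : Set} {size : ℕ}
             (enc : St → Fin size) (dec : Fin size → St)
             (dec-enc : ∀ s → dec (enc s) ≡ s) (enc-dec : ∀ q → enc (dec q) ≡ q)
             (Init : St → Set) (Step : St → Fin n → St → St → Set) (col : St → ℕ) where

  holds : {P : Set} → P → does (em {P}) ≡ true
  holds = dec-true em

  holds⁻¹ : {P : Set} → does (em {P}) ≡ true → P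
  holds⁻¹ {P} e with em {P}
  holds⁻¹ e  | yes p = p
  holds⁻¹ () | no  _

  auto : PTA n
  auto = record
    { m     = size
    ; init  = λ q → does (em {Init (dec q)})
    ; δ     = λ q a q₀ q₁ → does (em {Step (dec q) a (dec q₀) (dec q₁)})
    ; color = λ q → col (dec q)
    }

  record StRun (s : St) (t : Tree n) (χ : Node → St) : Set where
    field
      st-root   : χ [] ≡ s
      st-step   : ∀ v → Step (χ v) (t v) (χ (l ∷ v)) (χ (r ∷ v))
      st-accept : ∀ b → ParityAccepts (λ i → col (χ (branchNode b i)))
  open StRun public

  decode : ∀ {q t φ} → Run auto q t φ → StRun (dec q) t (dec ∘ φ)
  decode ρ = record
    { st-root = cong dec (root ρ) ; st-step = λ v → holds⁻¹ (step ρ v) ; st-accept = accept ρ }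

  step-enc : ∀ {s a s₀ s₁} → Step s a s₀ s₁ → δ auto (enc s) a (enc s₀) (enc s₁) ≡ true
  step-enc {s} {a} {s₀} {s₁} p rewrite dec-enc s | dec-enc s₀ | dec-enc s₁ = holds p

  encode : ∀ {s t χ} → StRun s t χ → Run auto (enc s) t (enc ∘ χ)
  encode {t = t} {χ} ρ = run (cong enc (st-root ρ)) step′
    (λ b → parity-cong (λ i → cong col (sym (dec-enc _))) (st-accept ρ b))
    where
    step′ : ∀ v → does (em {Step (dec (enc (χ v))) (t v) (dec (enc (χ (l ∷ v)))) (dec (enc (χ (r ∷ v))))}) ≡ true
    step′ v = step-enc (st-step ρ v)

  init-enc : ∀ {s} → Init s → init auto (enc s) ≡ true
  init-enc {s} i = holds (subst Init (sym (dec-enc s)) i)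

  init-dec : ∀ {t φ} → ACC auto t φ → Init (dec (φ []))
  init-dec acc = holds⁻¹ (proj₁ (proj₁ acc))

  dec-injective : ∀ {p q} → dec p ≡ dec q → p ≡ q
  dec-injective e = trans (sym (enc-dec _)) (trans (cong enc e) (enc-dec _))

-- Searching for a node labeled 1F

data Seek : Set where
  free seek along : Seek

-- `seek` promises a 1F at or below the node, `free` promises nothing, and `along` descends the
-- spine and starts a search in every tooth.
data SeekStep : Seek → Fin 2 → Seek → Seek → Set where
  skip  : ∀ {a} → SeekStep free a free free
  found : SeekStep seek 1F free free
  left  : ∀ {a} → SeekStep seek a seek free
  right : ∀ {a} → SeekStep seek a free seek
  watch : ∀ {a} → SeekStep along a along seek

-- The odd color rules out a search that goes on forever.
seekColor : Seek → ℕ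
seekColor seek = 1
seekColor _    = 0

module SeekAutomaton (em : ExcludedMiddle 0ℓ) (start : Seek) where

  encS : Seek → Fin 3
  encS free  = 0F
  encS seek  = 1F
  encS along = 2F

  decS : Fin 3 → Seek
  decS 0F = free
  decS 1F = seek
  decS 2F = along

  decS-encS : ∀ s → decS (encS s) ≡ s
  decS-encS free  = refl
  decS-encS seek  = refl
  decS-encS along = refl

  encS-decS : ∀ q → encS (decS q) ≡ q
  encS-decS 0F = refl
  encS-decS 1F = refl
  encS-decS 2F = refl

  open Build em encS decS decS-encS encS-decS (_≡ start) SeekStep seekColor public

  follows : Dir → List Dir → Maybe (List Dir)
  follows d []      = nothing
  follows d (e ∷ π) = if does (d ≟ᴰ e) then just π else nothing

  -- The directions still ahead of a search along `π`, or `nothing` off the path and past its end.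
  -- Unlike a node, `π` lists directions from the root downward.
  remaining : List Dir → Node → Maybe (List Dir)
  remaining π []      = just π
  remaining π (d ∷ v) = remaining π v >>= follows d

  seekIf : Maybe (List Dir) → Seek
  seekIf = maybe′ (λ _ → seek) free

  canon : List Dir → Node → Seek
  canon π v = seekIf (remaining π v)

  data Path (χ : Node → Seek) : Node → List Dir → Set where
    end : ∀ {v} → χ v ≡ seek → χ (l ∷ v) ≡ free → χ (r ∷ v) ≡ free → Path χ v []
    go  : ∀ {v π} d → χ v ≡ seek → Path χ (d ∷ v) π → Path χ v (d ∷ π)

  path-seek : ∀ {χ v π} → Path χ v π → χ v ≡ seek
  path-seek (end e _ _) = e
  path-seek (go _ e _)  = e

  module _ {t χ} (ρ : StRun seek t χ) where

    Stray : Node → Set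
    Stray v = χ v ≡ seek × ¬ ∃ (Path χ v)

    stray-child : ∀ v → Stray v → ∃[ d ] Stray (d ∷ v)
    stray-child v (sv , ¬p) with χ v in e | χ (l ∷ v) in el | χ (r ∷ v) in er | t v | st-step ρ v
    stray-child v (refl , ¬p) | _ | _ | _ | _ | found = contradiction ([] , end e el er) ¬p
    stray-child v (refl , ¬p) | _ | _ | _ | _ | left  = l , el , λ (π , p) → ¬p (l ∷ π , go l e p)
    stray-child v (refl , ¬p) | _ | _ | _ | _ | right = r , er , λ (π , p) → ¬p (r ∷ π , go r e p)

    -- Otherwise `follow` produces a branch of `seek` states only, with all colors 1, contradicting
    -- acceptance.
    path : ∃ (Path χ [])
    path = decidable-stable em λ ¬p →
      let b , stray = follow Stray (st-root ρ , ¬p) stray-child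
      in parity-≢1 (st-accept ρ b) (λ i → cong seekColor (proj₁ (stray i)))

    path-one : ∀ {v π} → Path χ v π → ∃[ w ] (t w ≡ 1F)
    path-one {v} (end e el er) with χ v | χ (l ∷ v) | χ (r ∷ v) | t v in et | st-step ρ v
    path-one {v} (end refl refl refl) | _ | _ | _ | _ | found = v , et
    path-one (go d _ p) = path-one p

    seek-one : ∃[ w ] (t w ≡ 1F)
    seek-one = path-one (proj₂ path)

    Matches : Node → Maybe (List Dir) → Set
    Matches v (just π) = Path χ v π
    Matches v nothing  = χ v ≡ free

    matches-step : ∀ d v m → Matches v m → Matches (d ∷ v) (m >>= follows d)
    matches-step d v nothing e with χ v | χ (l ∷ v) in el | χ (r ∷ v) in er | t v | st-step ρ v
    matches-step l v nothing refl | _ | _ | _ | _ | skip = el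
    matches-step r v nothing refl | _ | _ | _ | _ | skip = er
    matches-step l v (just []) (end _ el er) = el
    matches-step r v (just []) (end _ el er) = er
    matches-step l v (just (l ∷ π)) (go _ _ p) = p
    matches-step r v (just (r ∷ π)) (go _ _ p) = p
    matches-step l v (just (r ∷ π)) (go _ e p) with χ v | χ (l ∷ v) | χ (r ∷ v) | path-seek p | t v | st-step ρ v
    matches-step l v (just (r ∷ π)) (go _ refl p) | _ | _ | _ | refl | _ | right = refl
    matches-step r v (just (l ∷ π)) (go _ e p) with χ v | χ (l ∷ v) | χ (r ∷ v) | path-seek p | t v | st-step ρ v
    matches-step r v (just (l ∷ π)) (go _ refl p) | _ | _ | _ | refl | _ | left = refl

    matches : ∀ v → Matches v (remaining (proj₁ path) v)
    matches []      = proj₂ path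
    matches (d ∷ v) = matches-step d v _ (matches v)

    -- A run is determined by its finite path to the 1F it finds, so there are at most as many runs
    -- as nodes.
    seek-canon : ∀ v → χ v ≡ canon (proj₁ path) v
    seek-canon v with remaining (proj₁ path) v | matches v
    ... | just π  | p = path-seek p
    ... | nothing | e = e

  module _ {t : Tree 2} {u : Node} (one : t u ≡ 1F) where

    remaining-sound : ∀ v {π} → remaining (reverse u) v ≡ just π → π ʳ++ v ≡ u
    remaining-sound []      refl = reverse-involutive u
    remaining-sound (d ∷ v) e with remaining (reverse u) v in e′
    remaining-sound (l ∷ v) refl | just (l ∷ π) = remaining-sound v e′
    remaining-sound (r ∷ v) refl | just (r ∷ π) = remaining-sound v e′

    canon-step : ∀ v → SeekStep (canon (reverse u) v) (t v) (canon (reverse u) (l ∷ v)) (canon (reverse u) (r ∷ v))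
    canon-step v with remaining (reverse u) v in e
    ... | nothing      = skip
    ... | just (l ∷ π) = left
    ... | just (r ∷ π) = right
    ... | just []      = subst (λ a → SeekStep seek a free free)
                           (sym (trans (cong t (remaining-sound v e)) one)) found

    remaining-length : ∀ v {π} → remaining (reverse u) v ≡ just π → length v ≤ length (reverse u)
    remaining-length v {π} e = ≤-trans (m≤m+n (length v) (length π)) (≤-reflexive (lemma v e))
      where
      lemma : ∀ v {π} → remaining (reverse u) v ≡ just π → length v + length π ≡ length (reverse u)
      lemma []      refl = refl
      lemma (d ∷ v) e with remaining (reverse u) v in e′
      lemma (l ∷ v) refl | just (l ∷ π) = trans (sym (+-suc _ _)) (lemma v e′)
      lemma (r ∷ v) refl | just (r ∷ π) = trans (sym (+-suc _ _)) (lemma v e′)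

    seek-run : StRun seek t (canon (reverse u))
    seek-run = record
      { st-root   = refl
      ; st-step   = canon-step
      ; st-accept = λ b → parity-eventually (2 ∣0) (suc (length (reverse u))) (λ i le → free-at b i le)
      }
      where
      free-at : ∀ b i → length (reverse u) < i → seekColor (canon (reverse u) (branchNode b i)) ≡ 0
      free-at b i lt with remaining (reverse u) (branchNode b i) in e
      ... | nothing = refl
      ... | just π  = contradiction (subst (_≤ length (reverse u)) (length-branch b i)
                        (remaining-length (branchNode b i) e)) (<⇒≱ lt)

-- The countable and the uncountable case

next-node : Node → Node
next-node []      = l ∷ []
next-node (l ∷ v) = r ∷ v
next-node (r ∷ v) = l ∷ next-node v

-- Bijective base-two numeration with digits `l` and `r`, lowest digit first, which reaches every
-- node.
nth-node : ℕ → Node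
nth-node zero    = []
nth-node (suc i) = next-node (nth-node i)

nth-node-double : ∀ i → nth-node (suc (i + i)) ≡ l ∷ nth-node i
nth-node-double zero    = refl
nth-node-double (suc i) rewrite +-suc i i | nth-node-double i = refl

nth-node-surjective : ∀ v → ∃[ i ] (nth-node i ≡ v)
nth-node-surjective []      = 0 , refl
nth-node-surjective (l ∷ v) = let i , e = nth-node-surjective v in
  suc (i + i) , trans (nth-node-double i) (cong (l ∷_) e)
nth-node-surjective (r ∷ v) = let i , e = nth-node-surjective v in
  suc (suc (i + i)) , trans (cong next-node (nth-node-double i)) (cong (r ∷_) e)

countable-case : ExcludedMiddle 0ℓ → ∃[ n ] ∃[ A ] (CountablyAmbiguous {n} A × NoEquivalent FinitelyAmbiguous A)
countable-case em = 2 , auto , countable , not-finite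
  where
  open SeekAutomaton em seek
  st-run : ∀ {t φ} → ACC auto t φ → StRun seek t (decS ∘ φ)
  st-run {t} {φ} acc = subst (λ s → StRun s t (decS ∘ φ)) (init-dec acc) (decode (acc⇒run acc))
  countable : CountablyAmbiguous auto
  countable t = (λ i → encS ∘ canon (nth-node i)) , λ φ acc →
    let π , _ = path (st-run acc) ; i , e = nth-node-surjective π in
    i , λ v → dec-injective (trans (trans (decS-encS (canon (nth-node i) v)) (cong (λ π → canon π v) e))
                (sym (seek-canon (st-run acc) v)))
  not-finite : NoEquivalent FinitelyAmbiguous auto
  not-finite B same fin with decoy em B
  ... | y , (v , one) , inf with Equivalence.to (same y) (_ , run⇒acc (init-enc refl) (encode (seek-run one)))
  ...   | φ , acc = infinite⇒¬finite acc (inf (φ []) (φ , acc⇒run acc) not-blank) fin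
    where
    not-blank : ¬ Acc B (φ []) blank
    -- A run on the blank tree from this initial state would put the blank tree, which has no 1F,
    -- into the language.
    not-blank (ψ , ρ) with Equivalence.from (same blank) (ψ , accepting-state acc ρ)
    ... | χ , acc′ with seek-one (st-run acc′)
    ...   | _ , ()

uncountable-case : ExcludedMiddle 0ℓ → ∃[ n ] ∃[ A ] (NoEquivalent {n} CountablyAmbiguous A)
uncountable-case em = 2 , auto , not-countable
  where
  open SeekAutomaton em along
  seek-teeth : ∀ {t} → Accepts auto t → ∀ i → ∃[ w ] (sub t (tooth i) w ≡ 1F)
  seek-teeth {t} (φ , acc) i = seek-one
    (subst (λ s → StRun s (sub t (tooth i)) (decS ∘ sub φ (tooth i))) (proj₂ (on-spine i))
      (decode (subrun (acc⇒run acc) (tooth i))))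
    where
    on-spine : ∀ i → decS (φ (spine i)) ≡ along × decS (φ (tooth i)) ≡ seek
    on-spine i = along-at i , proj₂ (down i (along-at i))
      where
      down : ∀ i → decS (φ (spine i)) ≡ along →
             decS (φ (spine (suc i))) ≡ along × decS (φ (tooth i)) ≡ seek
      down i e with decS (φ (spine i)) | decS (φ (spine (suc i))) | decS (φ (tooth i))
                  | t (spine i) | st-step (decode (acc⇒run acc)) (spine i)
      down i refl | _ | _ | _ | _ | watch = refl , refl
      along-at : ∀ i → decS (φ (spine i)) ≡ along
      along-at zero    = init-dec acc
      along-at (suc i) = proj₁ (down i (along-at i))
  module _ (B : PTA 2) (same : SameLanguage auto B) {y : Tree 2} {φ : Labeling B}
           (acc : ACC B (comb (λ _ → 0F) (λ _ → y)) φ) where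

    tooth-run : ∀ i → Run B (φ (tooth i)) y (sub φ (tooth i))
    tooth-run i = run-tree (comb-tooth (λ _ → 0F) (λ _ → y) i) (subrun (acc⇒run {A = B} {φ = φ} acc) (tooth i))

    -- Otherwise exchanging tooth `i` alone for the blank tree gives an accepted comb with a tooth
    -- that lacks 1F.
    tooth-not-blank : ∀ i → ¬ Acc B (φ (tooth i)) blank
    tooth-not-blank i (ψ , σ) = impossible
      (seek-teeth (Equivalence.from (same t) (_ , regrow em {B = B} {t = comb (λ _ → 0F) (λ _ → y)} {φ} acc t ψs spine-eq runs)) i)
      where
      ts : ℕ → Tree 2
      ts = update i blank (λ _ → y)
      t : Tree 2
      t = comb (λ _ → 0F) ts
      ψs : ℕ → Labeling B
      ψs = update i ψ (λ j → sub φ (tooth j))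
      spine-eq : ∀ j → t (spine j) ≡ comb (λ _ → 0F) (λ _ → y) (spine j)
      spine-eq j = trans (comb-spine (λ _ → 0F) ts j) (sym (comb-spine (λ _ → 0F) (λ _ → y) j))
      local : ∀ j → Run B (φ (tooth j)) (ts j) (ψs j)
      local j with j ≟ i
      ... | yes refl = subst₂ (Run B (φ (tooth i))) (sym (update-same blank (λ _ → y) i)) (sym (update-same ψ (λ j → sub φ (tooth j)) i)) σ
      ... | no  ne   = subst₂ (Run B (φ (tooth j))) (sym (update-other blank (λ _ → y) i ne)) (sym (update-other ψ (λ j → sub φ (tooth j)) i ne))
                         (tooth-run j)
      runs : ∀ j → Run B (φ (tooth j)) (sub t (tooth j)) (ψs j)
      runs j = run-tree (λ w → sym (comb-tooth (λ _ → 0F) ts j w)) (local j)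
      impossible : ∃[ w ] (sub t (tooth i) w ≡ 1F) → ⊥
      impossible (w , e) with trans (sym e) (trans (comb-tooth (λ _ → 0F) ts i w)
                                               (cong (λ t → t w) (update-same blank (λ _ → y) i)))
      ... | ()

  comb-accepted : ∀ {y v} → y v ≡ 1F → Accepts auto (comb (λ _ → 0F) (λ _ → y))
  comb-accepted {y} {v} one = _ , run⇒acc (init-enc refl)
    (comb-run em (comb (λ _ → 0F) (λ _ → y)) (λ _ → encS along) (λ _ → encS seek)
      (λ _ → encS ∘ canon (reverse v))
      (λ _ → holds watch) (parity-eventually (2 ∣0) 0 (λ _ _ → refl))
      (λ i → run-tree (λ w → sym (comb-tooth (λ _ → 0F) (λ _ → y) i w)) (encode (seek-run one))))

  not-countable : NoEquivalent CountablyAmbiguous auto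
  not-countable B same count with decoy em B
  ... | y , (v , one) , inf with Equivalence.to (same (comb (λ _ → 0F) (λ _ → y))) (comb-accepted one)
  ...   | φ , acc = infinite-teeth⇒¬countable em acc
    (λ i → inf (φ (tooth i)) (_ , tooth-run B same acc i) (tooth-not-blank B same acc i)) count

-- Ambiguity forced by the choice of a tooth

comb-unique : {X : Set} {χ : Node → X} {p : ℕ → X} {ρ : ℕ → Node → X} →
              (∀ i → χ (spine i) ≡ p i) → (∀ i w → χ (w ++ tooth i) ≡ ρ i w) →
              ∀ v → χ v ≡ comb p ρ v
comb-unique {χ = χ} {p} {ρ} on-spine on-teeth v = lemma (G.loc v) refl
  where
  lemma : ∀ x → G.loc v ≡ x → χ v ≡ comb p ρ v
  lemma out e = subst (λ v → χ v ≡ comb p ρ v) (sym (loc-out⇒spine v e))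
    (trans (on-spine (length v)) (sym (comb-spine p ρ (length v))))
  lemma (inn s w) e with G.loc-sound v e
  ... | refl , ls = subst (λ s → χ (w ++ s) ≡ comb p ρ (w ++ s)) (sym (loc-cut⇒tooth s ls))
    (trans (on-teeth (length s ∸ 1) w) (sym (comb-tooth p ρ (length s ∸ 1) w)))

-- With the decoy y on all teeth but one blank one, every tooth choice has a run of its own.
-- Unless some decoy was recognized as not blank, all these runs survive on the all-blank comb,
-- and two coinciding ones would accept the comb with decoys only.
choices-differ : ExcludedMiddle 0ℓ → ∀ {B : PTA 2} {y} →
  (∀ q → Acc B q y → ¬ Acc B q blank → Infinite B q y) → ∀ σ k →
  (∀ (i : Fin (suc k)) → Accepts B (comb σ (update (toℕ i) blank (λ _ → y)))) →
  ¬ Accepts B (comb σ (λ _ → y)) → ¬ Ambiguous≤ k B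
choices-differ em {B} {y} inf σ k accepts rejects amb = rejects (recombine (amb empty φ′ φ′-acc))
  where
  ts : Fin (suc k) → ℕ → Tree 2
  ts i = update (toℕ i) blank (λ _ → y)
  empty : Tree 2
  empty = comb σ (λ _ → blank)
  φ : Fin (suc k) → Labeling B
  φ i = proj₁ (accepts i)
  φ-run : ∀ i → Run B (φ i []) (comb σ (ts i)) (φ i)
  φ-run i = acc⇒run {A = B} {φ = φ i} (proj₂ (accepts i))
  φ-tooth : ∀ i j → Run B (φ i (tooth j)) (ts i j) (sub (φ i) (tooth j))
  φ-tooth i j = run-tree (comb-tooth σ (ts i) j) (subrun (φ-run i) (tooth j))
  φ-decoy : ∀ i j → j ≢ toℕ i → Run B (φ i (tooth j)) y (sub (φ i) (tooth j))
  φ-decoy i j ne = subst (λ t → Run B (φ i (tooth j)) t (sub (φ i) (tooth j)))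
    (update-other blank (λ _ → y) (toℕ i) ne) (φ-tooth i j)
  φ-blank : ∀ i j → Acc B (φ i (tooth j)) blank
  φ-blank i j with j ≟ toℕ i
  ... | yes refl = _ , subst (λ t → Run B (φ i (tooth (toℕ i))) t (sub (φ i) (tooth (toℕ i))))
    (update-same blank (λ _ → y) (toℕ i)) (φ-tooth i (toℕ i))
  ... | no ne = decidable-stable em λ ¬blank →
    infinite⇒¬bounded {B = B} {φ = φ i} (proj₂ (accepts i))
      (infinite-above em (φ-run i) (tooth j)
        (infinite-tree (λ w → sym (trans (comb-tooth σ (ts i) j w)
                                    (cong (λ t → t w) (update-other blank (λ _ → y) (toℕ i) ne))))
          (inf _ (_ , φ-decoy i j ne) ¬blank)))
      k amb
    where
    infinite-tree : ∀ {q t t′} → (∀ v → t v ≡ t′ v) → Infinite B q t → Infinite B q t′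
    infinite-tree eq (φs , runs , distinct) = φs , (λ i → run-tree eq (runs i)) , distinct
  φ′ : Fin (suc k) → Labeling B
  φ′ i = comb (λ j → φ i (spine j)) (λ j → proj₁ (φ-blank i j))
  φ′-acc : ∀ i → ACC B empty (φ′ i)
  φ′-acc i = regrow em {B = B} {t = comb σ (ts i)} {φ i} (proj₂ (accepts i)) empty (λ j → proj₁ (φ-blank i j))
    (λ j → trans (comb-spine σ (λ _ → blank) j) (sym (comb-spine σ (ts i) j)))
    (λ j → run-tree (λ w → sym (comb-tooth σ (λ _ → blank) j w)) (proj₂ (φ-blank i j)))
  φ′-tooth : ∀ i j → φ′ i (tooth j) ≡ φ i (tooth j)
  φ′-tooth i j = trans (comb-tooth (λ j → φ i (spine j)) (λ j → proj₁ (φ-blank i j)) j [])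
    (root (proj₂ (φ-blank i j)))
  recombine : ∃[ i ] ∃[ j ] (i ≢ j × (∀ v → φ′ i v ≡ φ′ j v)) → Accepts B (comb σ (λ _ → y))
  recombine (i , i′ , i≢i′ , eq) = _ ,
    regrow em {B = B} {t = comb σ (ts i)} {φ i} (proj₂ (accepts i)) (comb σ (λ _ → y)) (λ j → proj₁ (decoys j))
      (λ j → trans (comb-spine σ (λ _ → y) j) (sym (comb-spine σ (ts i) j)))
      (λ j → run-tree (λ w → sym (comb-tooth σ (λ _ → y) j w)) (proj₂ (decoys j)))
    where
    decoys : ∀ j → Acc B (φ i (tooth j)) y
    decoys j with j ≟ toℕ i
    ... | no ne    = _ , φ-decoy i j ne
    -- Coincidence gives tooth `i` the same state in the run for `i′`, and that run reads a decoy
    -- there because `i ≢ i′`.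
    ... | yes refl = _ , run-root
      (trans (sym (φ′-tooth i′ (toℕ i))) (trans (sym (eq (tooth (toℕ i)))) (φ′-tooth i (toℕ i))))
      (φ-decoy i′ (toℕ i) (λ e → i≢i′ (Fin.toℕ-injective e)))

-- Choosing a blank tooth before the clock on the spine stops

-- `before` and `after` carry the clock down the spine until and after the choice of a tooth;
-- `clean` verifies that the chosen tooth is blank.
data Choice (K : ℕ) : Set where
  free clean   : Choice K
  before after : Fin K → Choice K

module ClockAutomaton (em : ExcludedMiddle 0ℓ) {K : ℕ} (start : Fin K)
                      (next : Fin K → Fin 2 → Maybe (Fin K)) where

  data ChoiceStep : Choice K → Fin 2 → Choice K → Choice K → Set where
    skip   : ∀ {a} → ChoiceStep free a free free
    empty  : ChoiceStep clean 0F clean clean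
    wait   : ∀ {c a c′} → next c a ≡ just c′ → ChoiceStep (before c) a (before c′) free
    choose : ∀ {c a c′} → next c a ≡ just c′ → ChoiceStep (before c) a (after c′) clean
    pass   : ∀ {c a c′} → next c a ≡ just c′ → ChoiceStep (after c) a (after c′) free
    stop   : ∀ {c a} → next c a ≡ nothing → ChoiceStep (after c) a free free

  -- The two odd colors enforce that a tooth is chosen and that the clock stops afterwards.
  choiceColor : Choice K → ℕ
  choiceColor (before _) = 1
  choiceColor (after _)  = 1
  choiceColor _          = 0

  encC : Choice K → Fin (2 + (K + K))
  encC free       = 0F
  encC clean      = 1F
  encC (before c) = Fin.suc (Fin.suc (c ↑ˡ K))
  encC (after c)  = Fin.suc (Fin.suc (K ↑ʳ c))

  decC : Fin (2 + (K + K)) → Choice K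
  decC 0F = free
  decC 1F = clean
  decC (Fin.suc (Fin.suc x)) = [ before , after ]′ (splitAt K x)

  decC-encC : ∀ s → decC (encC s) ≡ s
  decC-encC free       = refl
  decC-encC clean      = refl
  decC-encC (before c) = cong [ before , after ]′ (Fin.splitAt-↑ˡ K c K)
  decC-encC (after c)  = cong [ before , after ]′ (Fin.splitAt-↑ʳ K K c)

  encC-decC : ∀ q → encC (decC q) ≡ q
  encC-decC 0F = refl
  encC-decC 1F = refl
  encC-decC (Fin.suc (Fin.suc x)) = trans (lemma (splitAt K x))
    (cong (λ x → Fin.suc (Fin.suc x)) (Fin.join-splitAt K K x))
    where
    lemma : ∀ y → encC ([ before , after ]′ y) ≡ Fin.suc (Fin.suc (Fin.join K K y))
    lemma (inj₁ c) = refl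
    lemma (inj₂ c) = refl

  open Build em encC decC decC-encC encC-decC (_≡ before start) ChoiceStep choiceColor public

  clock : (ℕ → Fin 2) → ℕ → Maybe (Fin K)
  clock σ zero    = just start
  clock σ (suc i) = clock σ i >>= λ c → next c (σ i)

  clock-nothing : ∀ {σ} i k → clock σ i ≡ nothing → clock σ (k + i) ≡ nothing
  clock-nothing i zero    e = e
  clock-nothing i (suc k) e rewrite clock-nothing i k e = refl

  clock-just : ∀ {σ i k c} → i ≤ k → clock σ k ≡ just c → ∃[ c′ ] (clock σ i ≡ just c′)
  clock-just {σ} {i} {k} le e with clock σ i in e′
  ... | just c  = c , refl
  ... | nothing with trans (sym e) (trans (cong (clock σ) (sym (m∸n+n≡m le))) (clock-nothing i (k ∸ i) e′))
  ...   | ()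

  clock-cong : ∀ {σ σ′} → (∀ i → σ i ≡ σ′ i) → ∀ i → clock σ i ≡ clock σ′ i
  clock-cong eq zero    = refl
  clock-cong eq (suc i) rewrite clock-cong eq i | eq i = refl

  -- Choosing tooth `i` requires the clock to survive the step at `i`, hence the index `suc i`.
  Eligible : (ℕ → Fin 2) → ℕ → Set
  Eligible σ i = ∃[ c ] (clock σ (suc i) ≡ just c)

  Stops : (ℕ → Fin 2) → Set
  Stops σ = ∃[ i ] (clock σ i ≡ nothing)

  spineState : (ℕ → Fin 2) → ℕ → ℕ → Choice K
  spineState σ i j = maybe′ (if does (j ≤? i) then before else after) free (clock σ j)

  toothState : ℕ → ℕ → Choice K
  toothState i j = if does (j ≟ i) then clean else free

  canon : (ℕ → Fin 2) → ℕ → Node → Choice K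
  canon σ i = comb (spineState σ i) (λ j _ → toothState i j)

  spineState-≤ : ∀ {σ i j c} → j ≤ i → clock σ j ≡ just c → spineState σ i j ≡ before c
  spineState-≤ {i = i} {j} le e rewrite e | dec-true (j ≤? i) le = refl

  spineState-> : ∀ {σ i j} → i < j → spineState σ i j ≡ maybe′ after free (clock σ j)
  spineState-> {i = i} {j} lt rewrite dec-false (j ≤? i) (<⇒≱ lt) = refl

  toothState-≡ : ∀ i → toothState i i ≡ clean
  toothState-≡ i rewrite dec-true (i ≟ i) refl = refl

  toothState-≢ : ∀ {i j} → j ≢ i → toothState i j ≡ free
  toothState-≢ {i} {j} ne rewrite dec-false (j ≟ i) ne = refl

  module _ {t χ} (ρ : StRun (before start) t χ) where

    private
      σ : ℕ → Fin 2
      σ i = t (spine i)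

      spine-parity : ParityAccepts (λ i → choiceColor (χ (spine i)))
      spine-parity = parity-cong (λ i → cong (λ v → choiceColor (χ v)) (branch-spine i))
        (st-accept ρ (λ _ → l))

    clean-below : ∀ {v} → χ v ≡ clean → ∀ w → χ (w ++ v) ≡ clean
    clean-below e []      = e
    clean-below {v} e (d ∷ w) with χ (w ++ v) | clean-below e w | t (w ++ v)
      | χ (l ∷ w ++ v) in el | χ (r ∷ w ++ v) in er | st-step ρ (w ++ v)
    clean-below {v} e (l ∷ w) | _ | refl | _ | _ | _ | empty = el
    clean-below {v} e (r ∷ w) | _ | refl | _ | _ | _ | empty = er

    clean-blank : ∀ {v} → χ v ≡ clean → t v ≡ 0F
    clean-blank {v} e with χ v | t v | χ (l ∷ v) | χ (r ∷ v) | st-step ρ v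
    clean-blank refl | _ | _ | _ | _ | empty = refl

    free-below : ∀ {v} → χ v ≡ free → ∀ w → χ (w ++ v) ≡ free
    free-below e []      = e
    free-below {v} e (d ∷ w) with χ (w ++ v) | free-below e w
      | χ (l ∷ w ++ v) in el | χ (r ∷ w ++ v) in er | st-step ρ (w ++ v)
    free-below {v} e (l ∷ w) | _ | refl | _ | _ | skip = el
    free-below {v} e (r ∷ w) | _ | refl | _ | _ | skip = er

    wait-step : ∀ i {c} → χ (spine i) ≡ before c → χ (tooth i) ≢ clean →
                ∃[ c′ ] (next c (σ i) ≡ just c′ × χ (spine (suc i)) ≡ before c′ × χ (tooth i) ≡ free)
    wait-step i e ne with χ (spine i) | χ (spine (suc i)) | χ (tooth i) | st-step ρ (spine i)
    wait-step i refl ne | _ | _ | _ | wait n   = _ , n , refl , refl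
    wait-step i refl ne | _ | _ | _ | choose n = contradiction refl ne

    choose-step : ∀ i {c} → χ (spine i) ≡ before c → χ (tooth i) ≡ clean →
                  ∃[ c′ ] (next c (σ i) ≡ just c′ × χ (spine (suc i)) ≡ after c′)
    choose-step i e e′ with χ (spine i) | χ (spine (suc i)) | χ (tooth i) | st-step ρ (spine i)
    choose-step i refl refl | _ | _ | _ | choose n = _ , n , refl

    after-step : ∀ i m → χ (spine i) ≡ maybe′ after free m →
                 χ (spine (suc i)) ≡ maybe′ after free (m >>= λ c → next c (σ i)) × χ (tooth i) ≡ free
    after-step i m e with χ (spine i) | χ (spine (suc i)) | χ (tooth i) | st-step ρ (spine i)
    after-step i nothing  refl | _ | _ | _ | skip   = refl , refl
    after-step i (just c) refl | _ | _ | _ | pass n rewrite n = refl , refl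
    after-step i (just c) refl | _ | _ | _ | stop n rewrite n = refl , refl

    waiting : ¬ (∃[ i ] (χ (tooth i) ≡ clean)) → ∀ i → ∃[ c ] (χ (spine i) ≡ before c)
    waiting none zero    = start , st-root ρ
    waiting none (suc i) =
      let c , e = waiting none i
          c′ , _ , e′ , _ = wait-step i e (λ e → none (i , e)) in c′ , e′

    chosen : ∃[ i ] (χ (tooth i) ≡ clean)
    chosen = decidable-stable em λ none →
      parity-≢1 spine-parity (λ i → cong choiceColor (proj₂ (waiting none i)))

    -- The labels on the spine drive the clock, so the chosen tooth is the only freedom of a run.
    choice-canon : ∃[ i ] (Eligible σ i × Stops σ × (∀ w → t (w ++ tooth i) ≡ 0F) ×
                           (∀ v → χ v ≡ canon σ i v))
    -- Taking the first clean tooth guarantees `before` states up to `i`; that no later tooth is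
    -- clean follows from the `after` states.
    choice-canon with least em _ chosen
    ... | i , clean-i , first = i , eligible , stops ,
      (λ w → clean-blank (clean-below clean-i w)) , comb-unique on-spine on-teeth
      where
      until : ∀ j → j ≤ i → ∃[ c ] (clock σ j ≡ just c × χ (spine j) ≡ before c)
      until zero    le = start , refl , st-root ρ
      until (suc j) le with until j (<⇒≤ le)
      ... | c , ec , e with wait-step j e (first j le)
      ...   | c′ , n , e′ , _ = c′ , trans (cong (_>>= λ c → next c (σ j)) ec) n , e′
      chose : ∃[ c ] (clock σ (suc i) ≡ just c × χ (spine (suc i)) ≡ after c)
      chose with until i ≤-refl
      ... | c , ec , e with choose-step i e clean-i
      ...   | c′ , n , e′ = c′ , trans (cong (_>>= λ c → next c (σ i)) ec) n , e′
      eligible : Eligible σ i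
      eligible = proj₁ chose , proj₁ (proj₂ chose)
      since : ∀ k → χ (spine (k + suc i)) ≡ maybe′ after free (clock σ (k + suc i))
      since zero    = trans (proj₂ (proj₂ chose)) (sym (cong (maybe′ after free) (proj₁ (proj₂ chose))))
      since (suc k) = proj₁ (after-step (k + suc i) (clock σ (k + suc i)) (since k))
      since′ : ∀ j → i < j → χ (spine j) ≡ maybe′ after free (clock σ j)
      since′ j lt = subst (λ j → χ (spine j) ≡ maybe′ after free (clock σ j)) (m∸n+n≡m lt) (since (j ∸ suc i))
      stops : Stops σ
      stops = decidable-stable em λ never →
        parity-≢1 (parity-shift (suc i) spine-parity) λ k →
          trans (cong choiceColor (since k)) (running (clock σ (k + suc i)) λ e → never (k + suc i , e))
        where
        running : ∀ m → m ≢ nothing → choiceColor (maybe′ after free m) ≡ 1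
        running (just c) ne = refl
        running nothing  ne = contradiction refl ne
      on-spine : ∀ j → χ (spine j) ≡ spineState σ i j
      on-spine j with ≤-<-connex j i
      ... | inj₁ le = let c , ec , e = until j le in trans e (sym (spineState-≤ {σ} le ec))
      ... | inj₂ lt = trans (since′ j lt) (sym (spineState-> {σ} lt))
      tooth-free : ∀ j → j ≢ i → χ (tooth j) ≡ free
      tooth-free j ne with ≤-<-connex j i
      ... | inj₁ le = let lt = ≤∧≢⇒< le ne ; c , _ , e = until j le
                      in proj₂ (proj₂ (proj₂ (wait-step j e (first j lt))))
      ... | inj₂ lt = proj₂ (after-step j (clock σ j) (since′ j lt))
      on-teeth : ∀ j w → χ (w ++ tooth j) ≡ toothState i j
      on-teeth j w with j ≟ i
      ... | yes refl = trans (clean-below clean-i w) (sym (toothState-≡ j))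
      ... | no  ne   = trans (free-below (tooth-free j ne) w) (sym (toothState-≢ ne))

  module _ {t : Tree 2} {i : ℕ} (eligible : Eligible (λ j → t (spine j)) i) (stops : Stops (λ j → t (spine j)))
           (blank-i : ∀ w → t (w ++ tooth i) ≡ 0F) where

    private
      σ : ℕ → Fin 2
      σ j = t (spine j)

    canon-step : ∀ j → ChoiceStep (spineState σ i j) (σ j) (spineState σ i (suc j)) (toothState i j)
    canon-step j with ≤-<-connex j i
    canon-step j | inj₁ le with m≤n⇒m<n∨m≡n le | clock-just {σ} {j} (m≤n⇒m≤1+n le) (proj₂ eligible)
    ... | inj₁ lt | c , ec with clock-just {σ} {suc j} (s≤s le) (proj₂ eligible)
    ...   | c′ , ec′ rewrite spineState-≤ {σ} le ec | spineState-≤ {σ} lt ec′ | toothState-≢ (<⇒≢ lt) =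
      wait (trans (sym (cong (_>>= λ c → next c (σ j)) ec)) ec′)
    canon-step j | inj₁ le | inj₂ refl | c , ec
      rewrite spineState-≤ {σ} le ec | trans (spineState-> {σ} {j} (n<1+n j)) (cong (maybe′ after free) (proj₂ eligible))
            | toothState-≡ j =
      choose (trans (sym (cong (_>>= λ c → next c (σ j)) ec)) (proj₂ eligible))
    canon-step j | inj₂ lt
      rewrite spineState-> {σ} lt | spineState-> {σ} {i} {suc j} (m≤n⇒m≤1+n lt) | toothState-≢ (>⇒≢ lt)
      with clock σ j
    ... | nothing = skip
    ... | just c with next c (σ j) in n
    ...   | just c′ = pass n
    ...   | nothing = stop n

    canon-parity : ParityAccepts (λ j → choiceColor (spineState σ i j))
    canon-parity = parity-eventually (2 ∣0) (suc i + proj₁ stops) λ j le → cong choiceColor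
      (trans (spineState-> {σ} (≤-trans (m≤m+n (suc i) _) le))
        (cong (maybe′ after free)
          (subst (λ j → clock σ j ≡ nothing) (m∸n+n≡m (≤-trans (m≤n+m _ (suc i)) le))
            (clock-nothing (proj₁ stops) (j ∸ proj₁ stops) (proj₂ stops)))))

    canon-tooth : ∀ j → StRun (toothState i j) (sub t (tooth j)) (λ _ → toothState i j)
    canon-tooth j with j ≟ i
    ... | yes refl rewrite toothState-≡ j = record
      { st-root   = refl
      ; st-step   = λ v → subst (λ a → ChoiceStep clean a clean clean) (sym (blank-i v)) empty
      ; st-accept = λ _ → parity-eventually (2 ∣0) 0 (λ _ _ → refl) }
    ... | no ne rewrite toothState-≢ ne = record
      { st-root   = refl
      ; st-step   = λ _ → skip
      ; st-accept = λ _ → parity-eventually (2 ∣0) 0 (λ _ _ → refl) }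

    canonLabel : Labeling auto
    canonLabel = comb (λ j → encC (spineState σ i j)) (λ j _ → encC (toothState i j))

    canon-run : Run auto (encC (spineState σ i 0)) t canonLabel
    canon-run = comb-run em t (λ j → encC (spineState σ i j)) (λ j → encC (toothState i j))
      (λ j _ → encC (toothState i j)) (λ j → step-enc (canon-step j))
      (parity-cong (λ j → cong choiceColor (sym (decC-encC (spineState σ i j)))) canon-parity)
      (λ j → encode (canon-tooth j))

    canon-accepted : Accepts auto t
    canon-accepted = canonLabel ,
      run⇒acc {A = auto} {t = t} {canonLabel} (init-enc (spineState-≤ {σ} {i} z≤n refl)) canon-run

  acc-canon : ∀ {t φ} → ACC auto t φ →
    ∃[ i ] (Eligible (λ j → t (spine j)) i × Stops (λ j → t (spine j)) × (∀ w → t (w ++ tooth i) ≡ 0F) ×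
            (∀ v → φ v ≡ encC (canon (λ j → t (spine j)) i v)))
  acc-canon {t} {φ} acc =
    let i , eligible , stops , blank-i , eq = choice-canon {t} {decC ∘ φ} ρ
    in i , eligible , stops , blank-i , λ v → trans (sym (encC-decC (φ v))) (cong encC (eq v))
    where
    ρ : StRun (before start) t (decC ∘ φ)
    ρ = subst (λ s → StRun s t (decC ∘ φ)) (init-dec {t} {φ} acc) (decode (acc⇒run {A = auto} {t} {φ} acc))

  -- All combs with spine labels `σ` share one clock, so a blank tooth at any of the first `k + 1`
  -- positions is a legal choice, whereas decoys on all teeth leave no blank one.
  not-bounded : ∀ σ k → (∀ i → i < suc k → Eligible σ i) → Stops σ → NoEquivalent (Ambiguous≤ k) auto
  not-bounded σ k eligible (s , stopped) B same with decoy em B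
  ... | y , (v , one) , inf = choices-differ em inf σ k
    (λ i → Equivalence.to (same _) (accepted i))
    (λ acc → rejected (Equivalence.from (same _) acc))
    where
    on-spine : ∀ ts j → comb σ ts (spine j) ≡ σ j
    on-spine ts j = comb-spine σ ts j
    accepted : ∀ (i : Fin (suc k)) → Accepts auto (comb σ (update (toℕ i) blank (λ _ → y)))
    accepted i = canon-accepted {comb σ ts} {toℕ i}
      (let c , e = eligible (toℕ i) (Fin.toℕ<n i) in c , trans (clock-cong (on-spine ts) (suc (toℕ i))) e)
      (s , trans (clock-cong (on-spine ts) s) stopped)
      (λ w → trans (comb-tooth σ ts (toℕ i) w) (cong (λ t → t w) (update-same blank (λ _ → y) (toℕ i))))
      where
      ts : ℕ → Tree 2
      ts = update (toℕ i) blank (λ _ → y)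
    rejected : ¬ Accepts auto (comb σ (λ _ → y))
    rejected (φ , acc) =
      let i , _ , _ , blank-i , _ = acc-canon {comb σ (λ _ → y)} {φ} acc
      in Fin.0≢1+n (trans (sym (trans (sym (comb-tooth σ (λ _ → y) i v)) (blank-i v))) one)

-- The bounded and the finite case

bounded-case : ExcludedMiddle 0ℓ → ∀ k → 1 < k →
               ∃[ n ] ∃[ A ] (Ambiguous≤ {n} k A × NoEquivalent (Ambiguous≤ (k ∸ 1)) A)
bounded-case em k@(suc k′) _ = 2 , auto , upper , not-bounded (λ _ → 0F) k′ (λ i lt → running (suc i) lt) stops
  where
  -- Started at `k`, the clock runs at positions 0 to `k` whatever the labels are, so exactly the
  -- first `k` teeth are eligible.
  countdown : Fin (suc k) → Fin 2 → Maybe (Fin (suc k))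
  countdown Fin.zero    _ = nothing
  countdown (Fin.suc c) _ = just (inject₁ c)
  open ClockAutomaton em (fromℕ k) countdown
  tick : ∀ c {a c′} → countdown c a ≡ just c′ → toℕ c ≡ suc (toℕ c′)
  tick (Fin.suc c) refl = cong suc (sym (Fin.toℕ-inject₁ c))
  reading : ∀ {σ} j {c} → clock σ j ≡ just c → toℕ c + j ≡ k
  reading zero refl = trans (+-identityʳ _) (Fin.toℕ-fromℕ k)
  reading {σ} (suc j) {c} e with clock σ j in e′
  ... | just c₀ = trans (+-suc (toℕ c) j) (trans (cong (_+ j) (sym (tick c₀ e))) (reading {σ} j e′))
  running : ∀ {σ} j → j ≤ k → ∃[ c ] (clock σ j ≡ just c)
  running zero _ = fromℕ k , refl
  running {σ} (suc j) lt with running {σ} j (<⇒≤ lt)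
  ... | Fin.zero  , e = contradiction (reading {σ} j e) (<⇒≢ lt)
  ... | Fin.suc c , e rewrite e = inject₁ c , refl
  stops : ∀ {σ} → Stops σ
  stops {σ} = suc k , lemma (clock σ (suc k)) refl
    where
    lemma : ∀ m → clock σ (suc k) ≡ m → clock σ (suc k) ≡ nothing
    lemma nothing  e = e
    lemma (just c) e = contradiction (reading {σ} (suc k) e) (>⇒≢ (m≤n+m (suc k) (toℕ c)))
  upper : Ambiguous≤ k auto
  upper t φs accs = same-choice (Fin.pigeonhole (n<1+n k) (λ a → fromℕ< (choice<k a)))
    where
    σ : ℕ → Fin 2
    σ j = t (spine j)
    choice : ∀ a → _
    choice a = acc-canon {t} {φs a} (accs a)
    choice<k : ∀ a → proj₁ (choice a) < k
    choice<k a = let i , (c , e) , _ = choice a in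
      ≤-trans (m≤n+m (suc i) (toℕ c)) (≤-reflexive (reading {σ} (suc i) e))
    follows-choice : ∀ a v → φs a v ≡ encC (canon σ (proj₁ (choice a)) v)
    follows-choice a = proj₂ (proj₂ (proj₂ (proj₂ (choice a))))
    same-choice : ∃[ a ] ∃[ b ] (a Fin.< b × fromℕ< (choice<k a) ≡ fromℕ< (choice<k b)) →
                  ∃[ a ] ∃[ b ] (a ≢ b × (∀ v → φs a v ≡ φs b v))
    same-choice (a , b , a<b , e) = a , b , Fin.<⇒≢ a<b , λ v →
      trans (follows-choice a v)
        (trans (cong (λ i → encC (canon σ i v)) (Fin.fromℕ<-injective _ _ (choice<k a) (choice<k b) e))
          (sym (follows-choice b v)))

finite-case : ExcludedMiddle 0ℓ → ∃[ n ] ∃[ A ] (FinitelyAmbiguous {n} A × NoEquivalent BoundedlyAmbiguous A)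
finite-case em = 2 , auto , finite , unbounded
  where
  -- Stopping at the first 1F on the spine leaves finitely many eligible teeth in each accepted
  -- tree, but no common bound for all trees.
  untilOne : Fin 1 → Fin 2 → Maybe (Fin 1)
  untilOne c 0F = just c
  untilOne _ 1F = nothing
  open ClockAutomaton em 0F untilOne

  finite : FinitelyAmbiguous auto
  finite t with em {Stops (λ j → t (spine j))}
  ... | no  never = [] , λ φ acc →
    let _ , _ , stops , _ = acc-canon {t} {φ} acc in contradiction stops never
  ... | yes (s , stopped) = map candidate (upTo s) , λ φ acc →
    let i , (_ , e) , _ , _ , eq = acc-canon {t} {φ} acc in
    candidate i , ∈-map⁺ candidate (∈-upTo⁺ (i<s i e)) , λ v → sym (eq v)
    where
    σ : ℕ → Fin 2
    σ j = t (spine j)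
    candidate : ℕ → Labeling auto
    candidate i v = encC (canon σ i v)
    i<s : ∀ i {c} → clock σ (suc i) ≡ just c → i < s
    i<s i e = ≰⇒> λ s≤i → case-nothing (clock-just {σ} (m≤n⇒m≤1+n s≤i) e)
      where
      case-nothing : ∃[ c ] (clock σ s ≡ just c) → ⊥
      case-nothing (_ , e) with trans (sym stopped) e
      ... | ()

  unbounded : NoEquivalent BoundedlyAmbiguous auto
  unbounded B same (k , amb) = not-bounded σ k (λ i lt → 0F , running (suc i) lt) (suc (suc k) , stopped) B same amb
    where
    σ : ℕ → Fin 2
    -- With `k + 1` leading labels 0F, `k + 1` teeth are eligible, one more than the assumed bound
    -- on `B`.
    σ i = if does (i <? suc k) then 0F else 1F
    running : ∀ j → j ≤ suc k → clock σ j ≡ just 0F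
    running zero    _  = refl
    running (suc j) lt rewrite running j (<⇒≤ lt) | dec-true (j <? suc k) lt = refl
    stopped : clock σ (suc (suc k)) ≡ nothing
    stopped rewrite running (suc k) ≤-refl | dec-false (suc k <? suc k) (<-irrefl refl) = refl

theorem1p1 : ExcludedMiddle 0ℓ →
    ((k : ℕ) → 1 < k →
    ∃[ n ] ∃[ A ] (Ambiguous≤ {n} k A × NoEquivalent (Ambiguous≤ (k ∸ 1)) A))
    × (∃[ n ] ∃[ A ] (FinitelyAmbiguous {n} A × NoEquivalent BoundedlyAmbiguous A))
    × (∃[ n ] ∃[ A ] (CountablyAmbiguous {n} A × NoEquivalent FinitelyAmbiguous A))
    × (∃[ n ] ∃[ A ] (NoEquivalent {n} CountablyAmbiguous A))
theorem1p1 em = bounded-case em , finite-case em , countable-case em , uncountable-case em
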